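{- For every precomputed term $r$, the sentences $$\forall \mathbf{V} \left(\mathit{Atleast}^{\mathbf{X};\mathbf{V}}_F(\mathbf{V},r)\leftrightarrow \exists_{\geq r} \mathbf{X} F\right)\quad\text{and}\quad \forall \mathbf{V} \left(\mathit{Atmost}^{\mathbf{X};\mathbf{V}}_F(\mathbf{V},r)\leftrightarrow \exists_{\leq r}\mathbf{X} F\right)$$ (the set of all such sentences is called Defs) are provable in the deductive system $\mathit{HT}_{\#}$.
   Context: $\exists_{\geq r}\mathbf{X}F$ stands for $\exists\mathbf{X}_1\cdots\mathbf{X}_n(\bigwedge_{i=1}^nF^{\mathbf{X}}_{\mathbf{X}_i}\land\bigwedge_{i<j}\neg(\mathbf{X}_i=\mathbf{X}_j))$ if $r=\overline n>\overline 0$, $\top$ if $r\leq\overline 0$, and $\bot$ if $r>\overline n$ for all integers $n$; $\exists_{\leq r}\mathbf{X}F$ stands for $\forall\mathbf{X}_1\cdots\mathbf{X}_{n+1}(\bigwedge_{i=1}^{n+1}F^{\mathbf{X}}_{\mathbf{X}_i}\to\bigvee_{i<j}\mathbf{X}_i=\mathbf{X}_j)$ if $r=\overline n\geq\overline 0$, $\bot$ if $r<\overline 0$, $\top$ if $r>\overline n$ for all $n$ (the $\mathbf{X}_i$ fresh disjoint tuples). Formulas are over a two-sorted signature $\sigma_2$ (sorts general and integer) with numerals, other precomputed terms (totally ordered, numerals contiguous), integer arithmetic, predicates $p/n$, comparisons, and predicate constants $\mathit{Atleast}^{\mathbf{X};\mathbf{V}}_F$, $\mathit{Atmost}^{\mathbf{X};\mathbf{V}}_F$,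 $\mathit{Start}^{\mathbf{X};\mathbf{V}}_F$ for disjoint lists $\mathbf{X},\mathbf{V}$ of distinct general variables and $F$ over $\sigma_0$ (no Atleast/Atmost/Start) with free variables among $\mathbf{X},\mathbf{V}$. $\mathit{HT}_{\#}$ is first-order intuitionistic logic over $\sigma_2$ plus $F\lor(F\to G)\lor\neg G$, $\exists X(F\to\forall X F)$, Std (sentences over $\sigma_0$ without $p/n$ true in the standard interpretation), Ind (induction over nonnegative integers for all formulas over $\sigma_2$), $D_0$ (recursive definition: $\mathit{Start}^{\mathbf{X};\mathbf{V}}_F(\mathbf{X},\mathbf{V},N)$ for $N\leq\overline 0$; $\mathit{Start}^{\mathbf{X};\mathbf{V}}_F(\mathbf{X},\mathbf{V},\overline 1)\leftrightarrow F$; for $N>\overline 0$, $\mathit{Start}^{\mathbf{X};\mathbf{V}}_F(\mathbf{X},\mathbf{V},N+\overline 1)\leftrightarrow F\land\exists\mathbf{U}(\mathbf{X}<\mathbf{U}\land\mathit{Start}^{\mathbf{X};\mathbf{V}}_F(\mathbf{U},\mathbf{V},N))$, $<$ lexicographic) and $D_1$ ($\mathit{Atleast}^{\mathbf{X};\mathbf{V}}_F(\mathbf{V},Y)\leftrightarrow\exists\mathbf{X}N(\mathit{Start}^{\mathbf{X};\mathbf{V}}_F(\mathbf{X},\mathbf{V},N)\land N\geq Y)$, $\mathit{Atmost}^{\mathbf{X};\mathbf{V}}_F(\mathbf{V},Y)\leftrightarrow\forall\mathbf{X}N(\mathit{Start}^{\mathbf{X};\mathbf{V}}_F(\mathbf{X},\mathbf{V},N)\to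 N\leq Y)$, universally closed; $N$ integer, $Y$ general). -}

module Defs where

open import Data.Empty using (⊥; ⊥-elim)
open import Data.Fin.Base using (Fin; zero; suc; combine; _↑ˡ_; _↑ʳ_)
open import Data.Fin.Properties using () renaming (_<?_ to _<ᶠ?_)
open import Data.Integer.Base as ℤ using (ℤ; +_; -[1+_]; 0ℤ; 1ℤ)
open import Data.List.Base as List using (List; []; _∷_; allFin; cartesianProduct; filter)
open import Data.List.Membership.Propositional using (_∈_)
open import Data.Nat.Base using (ℕ; zero; suc; _+_; _*_)
open import Data.Product using (Σ; _×_; _,_; ∃; uncurry)
open import Data.Sum using (_⊎_)
open import Data.Vec.Base as Vec using (Vec; lookup; tabulate; _++_; []; _∷_)
open import Relation.Binary.Definitions using (Tri; tri<; tri≈; tri>)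
open import Relation.Binary.PropositionalEquality using (_≡_)
open import Relation.Binary.Structures using (IsStrictTotalOrder)
open import Relation.Nullary using (¬_)

data Precomputed (Other : Set) : Set where
  num   : ℤ → Precomputed Other
  other : Other → Precomputed Other

record Language : Set₁ where
  infix 4 _≺_
  field
    Other              : Set
    PredSym            : Set
    _≺_                : Precomputed Other → Precomputed Other → Set
    isStrictTotalOrder : IsStrictTotalOrder _≡_ _≺_
    num-mono           : ∀ {a b} → a ℤ.< b → num a ≺ num b
    contiguous         : ∀ {a b t} → num a ≺ t → t ≺ num b → ∃ λ c → t ≡ num c

  open IsStrictTotalOrder isStrictTotalOrder public
    using (compare)

data Comparison : Set where
  ≠ < > ≤ ≥ : Comparison

module HT# (L : Language) where
  open Language L

  Term : Set
  Term = Precomputed Other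

  -- Well-scoped de Bruijn syntax.  General and integer variables are numbered
  -- separately: a scope is a pair (g , i) of the numbers of variables of the
  -- two sorts.

  data ITerm (i : ℕ) : Set where
    ivar          : Fin i → ITerm i
    numeral       : ℤ → ITerm i
    _⊕_ _⊖_ _⊗_   : ITerm i → ITerm i → ITerm i
    abs           : ITerm i → ITerm i

  -- `int` expresses that integer is a subsort of general.
  data GTerm (g i : ℕ) : Set where
    gvar  : Fin g → GTerm g i
    const : Other → GTerm g i
    int   : ITerm i → GTerm g i

  precomputed : ∀ {g i} → Term → GTerm g i
  precomputed (num n)   = int (numeral n)
  precomputed (other c) = const c

  infix  7 _≐_
  infixr 6 _∧_
  infixr 5 _∨_
  infixr 4 _⇒_

  -- P a b is the set of predicate constants that take a general arguments
  -- followed by b integer arguments.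
  data Form (P : ℕ → ℕ → Set) (g i : ℕ) : Set where
    _≐_         : GTerm g i → GTerm g i → Form P g i
    cmp         : Comparison → GTerm g i → GTerm g i → Form P g i
    atom        : ∀ {a b} → P a b → Vec (GTerm g i) a → Vec (ITerm i) b → Form P g i
    ⊥ᶠ          : Form P g i
    _∧_ _∨_ _⇒_ : Form P g i → Form P g i → Form P g i
    ∀ᵍ ∃ᵍ       : Form P (suc g) i → Form P g i
    ∀ⁱ ∃ⁱ       : Form P g (suc i) → Form P g i

  module _ {P : ℕ → ℕ → Set} where
    infix 8 ~_
    infix 3 _⇔_

    ~_ : ∀ {g i} → Form P g i → Form P g i
    ~ A = A ⇒ ⊥ᶠ

    ⊤ᶠ : ∀ {g i} → Form P g i
    ⊤ᶠ = ~ ⊥ᶠ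

    _⇔_ : ∀ {g i} → Form P g i → Form P g i → Form P g i
    A ⇔ B = (A ⇒ B) ∧ (B ⇒ A)

    ⋀ ⋁ : ∀ {g i} → List (Form P g i) → Form P g i
    ⋀ = List.foldr _∧_ ⊤ᶠ
    ⋁ = List.foldr _∨_ ⊥ᶠ

    -- Quantification over the n most recently bound general variables.
    ∀ᵍ* ∃ᵍ* : ∀ n {g i} → Form P (n + g) i → Form P g i
    ∀ᵍ* zero    A = A
    ∀ᵍ* (suc n) A = ∀ᵍ* n (∀ᵍ A)
    ∃ᵍ* zero    A = A
    ∃ᵍ* (suc n) A = ∃ᵍ* n (∃ᵍ A)

    closeᵍ : ∀ {g} → Form P g 0 → Form P 0 0
    closeᵍ {zero}  A = A
    closeᵍ {suc g} A = closeᵍ (∀ᵍ A)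

    -- Universal closure.
    close : ∀ {g i} → Form P g i → Form P 0 0
    close {i = zero}  A = closeᵍ A
    close {i = suc i} A = close (∀ⁱ A)

  mapPred : ∀ {P Q : ℕ → ℕ → Set} → (∀ {a b} → P a b → Q a b) →
            ∀ {g i} → Form P g i → Form Q g i
  mapPred f (s ≐ t)        = s ≐ t
  mapPred f (cmp c s t)    = cmp c s t
  mapPred f (atom p ts us) = atom (f p) ts us
  mapPred f ⊥ᶠ             = ⊥ᶠ
  mapPred f (A ∧ B)        = mapPred f A ∧ mapPred f B
  mapPred f (A ∨ B)        = mapPred f A ∨ mapPred f B
  mapPred f (A ⇒ B)        = mapPred f A ⇒ mapPred f B
  mapPred f (∀ᵍ A)         = ∀ᵍ (mapPred f A)
  mapPred f (∃ᵍ A)         = ∃ᵍ (mapPred f A)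
  mapPred f (∀ⁱ A)         = ∀ⁱ (mapPred f A)
  mapPred f (∃ⁱ A)         = ∃ⁱ (mapPred f A)

  substᴵ : ∀ {i j} → (Fin i → ITerm j) → ITerm i → ITerm j
  substᴵ τ (ivar x)    = τ x
  substᴵ τ (numeral n) = numeral n
  substᴵ τ (s ⊕ t)     = substᴵ τ s ⊕ substᴵ τ t
  substᴵ τ (s ⊖ t)     = substᴵ τ s ⊖ substᴵ τ t
  substᴵ τ (s ⊗ t)     = substᴵ τ s ⊗ substᴵ τ t
  substᴵ τ (abs t)     = abs (substᴵ τ t)

  substᴳ : ∀ {g h i j} → (Fin g → GTerm h j) → (Fin i → ITerm j) → GTerm g i → GTerm h j
  substᴳ σ τ (gvar x)  = σ x
  substᴳ σ τ (const c) = const c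
  substᴳ σ τ (int t)   = int (substᴵ τ t)

  extend : ∀ {n} {A : Set} → A → (Fin n → A) → Fin (suc n) → A
  extend a f zero    = a
  extend a f (suc x) = f x

  subst : ∀ {P g h i j} → (Fin g → GTerm h j) → (Fin i → ITerm j) → Form P g i → Form P h j
  subst σ τ (s ≐ t)        = substᴳ σ τ s ≐ substᴳ σ τ t
  subst σ τ (cmp c s t)    = cmp c (substᴳ σ τ s) (substᴳ σ τ t)
  subst σ τ (atom p ts us) = atom p (Vec.map (substᴳ σ τ) ts) (Vec.map (substᴵ τ) us)
  subst σ τ ⊥ᶠ             = ⊥ᶠ
  subst σ τ (A ∧ B)        = subst σ τ A ∧ subst σ τ B
  subst σ τ (A ∨ B)        = subst σ τ A ∨ subst σ τ B
  subst σ τ (A ⇒ B)        = subst σ τ A ⇒ subst σ τ B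
  subst σ τ (∀ᵍ A)         = ∀ᵍ (subst (extend (gvar zero) (λ x → substᴳ (λ y → gvar (suc y)) ivar (σ x))) τ A)
  subst σ τ (∃ᵍ A)         = ∃ᵍ (subst (extend (gvar zero) (λ x → substᴳ (λ y → gvar (suc y)) ivar (σ x))) τ A)
  subst σ τ (∀ⁱ A)         = ∀ⁱ (subst (λ x → substᴳ gvar (λ y → ivar (suc y)) (σ x))
                                       (extend (ivar zero) (λ x → substᴵ (λ y → ivar (suc y)) (τ x))) A)
  subst σ τ (∃ⁱ A)         = ∃ⁱ (subst (λ x → substᴳ gvar (λ y → ivar (suc y)) (σ x))
                                       (extend (ivar zero) (λ x → substᴵ (λ y → ivar (suc y)) (τ x))) A)

  weakenᵍ : ∀ {P g i} → Form P g i → Form P (suc g) i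
  weakenᵍ = subst (λ x → gvar (suc x)) ivar

  weakenⁱ : ∀ {P g i} → Form P g i → Form P g (suc i)
  weakenⁱ = subst gvar (λ x → ivar (suc x))

  infix 9 _[_]ᵍ _[_]ⁱ _⟨_⟩

  _[_]ᵍ : ∀ {P g i} → Form P (suc g) i → GTerm g i → Form P g i
  A [ t ]ᵍ = subst (extend t gvar) ivar A

  _[_]ⁱ : ∀ {P g i} → Form P g (suc i) → ITerm i → Form P g i
  A [ t ]ⁱ = subst gvar (extend t ivar) A

  -- Replaces the free variables of a formula without free integer variables.
  _⟨_⟩ : ∀ {P n g i} → Form P n 0 → Vec (GTerm g i) n → Form P g i
  A ⟨ ts ⟩ = subst (lookup ts) (λ ()) A

  embed : ∀ {P g i} → Form P 0 0 → Form P g i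
  embed A = A ⟨ [] ⟩

  data NoPred : ℕ → ℕ → Set where

  data σ₀ : ℕ → ℕ → Set where
    pred : PredSym → ∀ n → σ₀ n 0

  -- In Atleast, Atmost and Start indexed by F : Form σ₀ (m + k) 0, the first m
  -- variables of F form the list X and the remaining k form the list V.
  -- Arguments: Atleast (V , Y), Atmost (V , Y), Start (X , V , N).
  data σ₂ : ℕ → ℕ → Set where
    base           : ∀ {a b} → σ₀ a b → σ₂ a b
    Atleast Atmost : ∀ m k → Form σ₀ (m + k) 0 → σ₂ (k + 1) 0
    Start          : ∀ m k → Form σ₀ (m + k) 0 → σ₂ (m + k) 1

  ⌈_⌉ : ∀ {g i} → Form σ₀ g i → Form σ₂ g i
  ⌈_⌉ = mapPred base

  module _ {P : ℕ → ℕ → Set} {g i : ℕ} where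
    infix 7 _≐*_ _<lex_

    _≐*_ : ∀ {m} → Vec (GTerm g i) m → Vec (GTerm g i) m → Form P g i
    _≐*_ {m} ts us = ⋀ (List.map (λ l → lookup ts l ≐ lookup us l) (allFin m))

    -- Lexicographic order: ⋁ₗ ((⋀_{j<l} tⱼ = uⱼ) ∧ tₗ < uₗ).
    _<lex_ : ∀ {m} → Vec (GTerm g i) m → Vec (GTerm g i) m → Form P g i
    _<lex_ {m} ts us = ⋁ (List.map disjunct (allFin m))
      where
      disjunct : Fin m → Form P g i
      disjunct l = ⋀ (List.map (λ j → lookup ts j ≐ lookup us j) (filter (_<ᶠ? l) (allFin m)))
                 ∧ cmp < (lookup ts l) (lookup us l)

  -- Truth in the standard interpretation is classical truth: ∨ and ∃ carry a
  -- double negation, and atomic formulas are decidable.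

  evalᴵ : ∀ {i} → (Fin i → ℤ) → ITerm i → ℤ
  evalᴵ ν (ivar x)    = ν x
  evalᴵ ν (numeral n) = n
  evalᴵ ν (s ⊕ t)     = evalᴵ ν s ℤ.+ evalᴵ ν t
  evalᴵ ν (s ⊖ t)     = evalᴵ ν s ℤ.- evalᴵ ν t
  evalᴵ ν (s ⊗ t)     = evalᴵ ν s ℤ.* evalᴵ ν t
  evalᴵ ν (abs t)     = + ℤ.∣ evalᴵ ν t ∣

  evalᴳ : ∀ {g i} → (Fin g → Term) → (Fin i → ℤ) → GTerm g i → Term
  evalᴳ μ ν (gvar x)  = μ x
  evalᴳ μ ν (const c) = other c
  evalᴳ μ ν (int t)   = num (evalᴵ ν t)

  compares : Comparison → Term → Term → Set
  compares ≠ s t = ¬ (s ≡ t)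
  compares < s t = s ≺ t
  compares > s t = t ≺ s
  compares ≤ s t = s ≺ t ⊎ s ≡ t
  compares ≥ s t = t ≺ s ⊎ s ≡ t

  ⟦_⟧ : ∀ {g i} → Form NoPred g i → (Fin g → Term) → (Fin i → ℤ) → Set
  ⟦ s ≐ t ⟧        μ ν = evalᴳ μ ν s ≡ evalᴳ μ ν t
  ⟦ cmp c s t ⟧    μ ν = compares c (evalᴳ μ ν s) (evalᴳ μ ν t)
  ⟦ atom () ts us ⟧
  ⟦ ⊥ᶠ ⟧           μ ν = ⊥
  ⟦ A ∧ B ⟧        μ ν = ⟦ A ⟧ μ ν × ⟦ B ⟧ μ ν
  ⟦ A ∨ B ⟧        μ ν = ¬ ¬ (⟦ A ⟧ μ ν ⊎ ⟦ B ⟧ μ ν)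
  ⟦ A ⇒ B ⟧        μ ν = ⟦ A ⟧ μ ν → ⟦ B ⟧ μ ν
  ⟦ ∀ᵍ A ⟧         μ ν = ∀ t → ⟦ A ⟧ (extend t μ) ν
  ⟦ ∃ᵍ A ⟧         μ ν = ¬ ¬ (Σ Term λ t → ⟦ A ⟧ (extend t μ) ν)
  ⟦ ∀ⁱ A ⟧         μ ν = ∀ n → ⟦ A ⟧ μ (extend n ν)
  ⟦ ∃ⁱ A ⟧         μ ν = ¬ ¬ (Σ ℤ λ n → ⟦ A ⟧ μ (extend n ν))

  True : Form NoPred 0 0 → Set
  True A = ⟦ A ⟧ (λ ()) (λ ())

  Sentence : Set
  Sentence = Form σ₂ 0 0

  inductionFormula : ∀ {g i} → Form σ₂ g (suc i) → Form σ₂ g i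
  inductionFormula {g} {i} A =
    A [ numeral 0ℤ ]ⁱ ∧ ∀ⁱ (N≥0 ∧ A ⇒ A[N+1]) ⇒ ∀ⁱ (N≥0 ⇒ A)
    where
    N≥0 A[N+1] : Form σ₂ g (suc i)
    N≥0    = cmp ≥ (int (ivar zero)) (int (numeral 0ℤ))
    A[N+1] = subst gvar (extend (ivar zero ⊕ numeral 1ℤ) (λ x → ivar (suc x))) A

  module D₀ (m k : ℕ) (F : Form σ₀ (m + k) 0) where

    start : ∀ {g i} → Vec (GTerm g i) m → Vec (GTerm g i) k → ITerm i → Form σ₂ g i
    start xs vs n = atom (Start m k F) (xs ++ vs) (n ∷ [])

    module _ {i : ℕ} where
      X : Vec (GTerm (m + k) i) m
      X = tabulate λ j → gvar (j ↑ˡ k)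

      V : Vec (GTerm (m + k) i) k
      V = tabulate λ j → gvar (m ↑ʳ j)

      -- The same variables, and the new variables U, under ∃ U.
      U′ X′ : Vec (GTerm (m + (m + k)) i) m
      U′ = tabulate λ j → gvar (j ↑ˡ (m + k))
      X′ = tabulate λ j → gvar (m ↑ʳ (j ↑ˡ k))

      V′ : Vec (GTerm (m + (m + k)) i) k
      V′ = tabulate λ j → gvar (m ↑ʳ (m ↑ʳ j))

    N : ITerm 1
    N = ivar zero

    start-≤0 : Form σ₂ (m + k) 1
    start-≤0 = cmp ≤ (int N) (int (numeral 0ℤ)) ⇒ start X V N

    start-1 : Form σ₂ (m + k) 0
    start-1 = start X V (numeral 1ℤ) ⇔ ⌈ F ⌉

    start-+1 : Form σ₂ (m + k) 1
    start-+1 = cmp > (int N) (int (numeral 0ℤ)) ⇒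
      (start X V (N ⊕ numeral 1ℤ) ⇔ ⌈ F ⌉ ⟨ X ++ V ⟩ ∧ ∃ᵍ* m (X′ <lex U′ ∧ start U′ V′ N))

  module D₁ (m k : ℕ) (F : Form σ₀ (m + k) 0) where
    open D₀ m k F using (start)

    atleast atmost : ∀ {g i} → Vec (GTerm g i) k → GTerm g i → Form σ₂ g i
    atleast vs y = atom (Atleast m k F) (vs ++ y ∷ []) []
    atmost  vs y = atom (Atmost m k F) (vs ++ y ∷ []) []

    V : Vec (GTerm (suc k) 0) k
    V = tabulate λ j → gvar (suc j)

    Y : GTerm (suc k) 0
    Y = gvar zero

    -- Under the quantifiers binding X and N.
    X′ : Vec (GTerm (m + suc k) 1) m
    X′ = tabulate λ j → gvar (j ↑ˡ suc k)

    V′ : Vec (GTerm (m + suc k) 1) k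
    V′ = tabulate λ j → gvar (m ↑ʳ suc j)

    Y′ : GTerm (m + suc k) 1
    Y′ = gvar (m ↑ʳ zero)

    N : ITerm 1
    N = ivar zero

    -- V when it is the whole scope.
    V₀ : Vec (GTerm k 0) k
    V₀ = tabulate gvar

    def-atleast def-atmost : Form σ₂ (suc k) 0
    def-atleast = atleast V Y ⇔ ∃ᵍ* m (∃ⁱ (start X′ V′ N ∧ cmp ≥ (int N) Y′))
    def-atmost  = atmost V Y ⇔ ∀ᵍ* m (∀ⁱ (start X′ V′ N ⇒ cmp ≤ (int N) Y′))

  data Axiom : Sentence → Set where
    ax-std      : ∀ A → True A → Axiom (mapPred (λ ()) A)
    ax-ind      : ∀ {g i} (A : Form σ₂ g (suc i)) → Axiom (close (inductionFormula A))
    ax-start-≤0 : ∀ m k F → Axiom (close (D₀.start-≤0 m k F))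
    ax-start-1  : ∀ m k F → Axiom (close (D₀.start-1 m k F))
    ax-start-+1 : ∀ m k F → Axiom (close (D₀.start-+1 m k F))
    ax-atleast  : ∀ m k F → Axiom (close (D₁.def-atleast m k F))
    ax-atmost   : ∀ m k F → Axiom (close (D₁.def-atmost m k F))

  infix 2 _⊢_

  data _⊢_ {g i : ℕ} (Γ : List (Form σ₂ g i)) : Form σ₂ g i → Set where
    hyp   : ∀ {A} → A ∈ Γ → Γ ⊢ A
    ⊥E    : ∀ {A} → Γ ⊢ ⊥ᶠ → Γ ⊢ A
    ∧I    : ∀ {A B} → Γ ⊢ A → Γ ⊢ B → Γ ⊢ A ∧ B
    ∧E₁   : ∀ {A B} → Γ ⊢ A ∧ B → Γ ⊢ A
    ∧E₂   : ∀ {A B} → Γ ⊢ A ∧ B → Γ ⊢ B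
    ∨I₁   : ∀ {A B} → Γ ⊢ A → Γ ⊢ A ∨ B
    ∨I₂   : ∀ {A B} → Γ ⊢ B → Γ ⊢ A ∨ B
    ∨E    : ∀ {A B C} → Γ ⊢ A ∨ B → A ∷ Γ ⊢ C → B ∷ Γ ⊢ C → Γ ⊢ C
    ⇒I    : ∀ {A B} → A ∷ Γ ⊢ B → Γ ⊢ A ⇒ B
    ⇒E    : ∀ {A B} → Γ ⊢ A ⇒ B → Γ ⊢ A → Γ ⊢ B
    ∀ᵍI   : ∀ {A} → List.map weakenᵍ Γ ⊢ A → Γ ⊢ ∀ᵍ A
    ∀ᵍE   : ∀ {A} t → Γ ⊢ ∀ᵍ A → Γ ⊢ A [ t ]ᵍ
    ∃ᵍI   : ∀ {A} t → Γ ⊢ A [ t ]ᵍ → Γ ⊢ ∃ᵍ A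
    ∃ᵍE   : ∀ {A C} → Γ ⊢ ∃ᵍ A → A ∷ List.map weakenᵍ Γ ⊢ weakenᵍ C → Γ ⊢ C
    ∀ⁱI   : ∀ {A} → List.map weakenⁱ Γ ⊢ A → Γ ⊢ ∀ⁱ A
    ∀ⁱE   : ∀ {A} t → Γ ⊢ ∀ⁱ A → Γ ⊢ A [ t ]ⁱ
    ∃ⁱI   : ∀ {A} t → Γ ⊢ A [ t ]ⁱ → Γ ⊢ ∃ⁱ A
    ∃ⁱE   : ∀ {A C} → Γ ⊢ ∃ⁱ A → A ∷ List.map weakenⁱ Γ ⊢ weakenⁱ C → Γ ⊢ C
    ≐I    : ∀ t → Γ ⊢ t ≐ t
    ≐Eᵍ   : ∀ A {s t} → Γ ⊢ s ≐ t → Γ ⊢ A [ s ]ᵍ → Γ ⊢ A [ t ]ᵍ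
    ≐Eⁱ   : ∀ A {s t} → Γ ⊢ int s ≐ int t → Γ ⊢ A [ s ]ⁱ → Γ ⊢ A [ t ]ⁱ
    hosoi : ∀ A B → Γ ⊢ A ∨ (A ⇒ B) ∨ ~ B
    sqhtᵍ : ∀ A → Γ ⊢ ∃ᵍ (A ⇒ weakenᵍ (∀ᵍ A))
    sqhtⁱ : ∀ A → Γ ⊢ ∃ⁱ (A ⇒ weakenⁱ (∀ⁱ A))
    axiom : ∀ {A} → Axiom A → Γ ⊢ embed A

  Provable : Sentence → Set
  Provable A = [] ⊢ A

  -- By contiguity, a precomputed term that is not a numeral is below all
  -- numerals or above all of them.
  data Position : Term → Set where
    isNum : ∀ n → Position (num n)
    below : ∀ {r} → (∀ n → r ≺ num n) → Position r
    above : ∀ {r} → (∀ n → num n ≺ r) → Position r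

  private
    other≢num : ∀ {c n} → ¬ (other {Other} c ≡ num n)
    other≢num ()

    not-between : ∀ {a b c} → num a ≺ other c → other c ≺ num b → ⊥
    not-between p q with contiguous p q
    ... | _ , ()

  position : ∀ r → Position r
  position (num n) = isNum n
  position (other c) with compare (other c) (num 0ℤ)
  ... | tri≈ _ e _ = ⊥-elim (other≢num e)
  ... | tri< l _ _ = below λ n → go n (compare (other c) (num n))
    where
    go : ∀ n → Tri (other c ≺ num n) (other c ≡ num n) (num n ≺ other c) → other c ≺ num n
    go n (tri< p _ _) = p
    go n (tri≈ _ e _) = ⊥-elim (other≢num e)
    go n (tri> _ _ p) = ⊥-elim (not-between p l)
  ... | tri> _ _ g = above λ n → go n (compare (other c) (num n))
    where
    go : ∀ n → Tri (other c ≺ num n) (other c ≡ num n) (num n ≺ other c) → num n ≺ other c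
    go n (tri< p _ _) = ⊥-elim (not-between g p)
    go n (tri≈ _ e _) = ⊥-elim (other≢num e)
    go n (tri> _ _ p) = p

  module Counting (m k : ℕ) (F : Form σ₀ (m + k) 0) where
    open D₁ m k F public using (atleast; atmost; V₀)

    -- n disjoint copies X₁, …, Xₙ of the list X, followed by V.
    module _ (n : ℕ) where
      copy : Fin n → Vec (GTerm (n * m + k) 0) m
      copy a = tabulate λ j → gvar (combine a j ↑ˡ k)

      V : Vec (GTerm (n * m + k) 0) k
      V = tabulate λ j → gvar ((n * m) ↑ʳ j)

      F-all : Form σ₂ (n * m + k) 0
      F-all = ⋀ (List.map (λ a → ⌈ F ⌉ ⟨ copy a ++ V ⟩) (allFin n))

      pairs : List (Fin n × Fin n)
      pairs = filter (uncurry _<ᶠ?_) (cartesianProduct (allFin n) (allFin n))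

      distinct someEqual : Form σ₂ (n * m + k) 0
      distinct  = ⋀ (List.map (λ (a , b) → ~ (copy a ≐* copy b)) pairs)
      someEqual = ⋁ (List.map (λ (a , b) → copy a ≐* copy b) pairs)

    ∃≥ : Term → Form σ₂ k 0
    ∃≥ r with position r
    ... | isNum (+ suc n)  = ∃ᵍ* (suc n * m) (F-all (suc n) ∧ distinct (suc n))
    ... | isNum (+ zero)   = ⊤ᶠ
    ... | isNum (-[1+ _ ]) = ⊤ᶠ
    ... | below _          = ⊤ᶠ
    ... | above _          = ⊥ᶠ

    ∃≤ : Term → Form σ₂ k 0
    ∃≤ r with position r
    ... | isNum (+ n)      = ∀ᵍ* (suc n * m) (F-all (suc n) ⇒ someEqual (suc n))
    ... | isNum (-[1+ _ ]) = ⊥ᶠ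
    ... | below _          = ⊥ᶠ
    ... | above _          = ⊤ᶠ

{-# OPTIONS --safe #-}
-- Start(X, V, n) says that X is the least element of an increasing chain of n tuples satisfying F.
-- If Start(X, V, N) with N ≥ n > 0, then unfolding D₀ n times, each time writing N = (N - 1) + 1,
-- produces n lexicographically increasing, hence distinct, tuples; the recursion on n takes place
-- in the metatheory.  Conversely, n distinct tuples can be sorted by case
-- distinctions, because Std proves that the lexicographic order is total, and a sorted list gives
-- Start by D₀.  For Atmost, Std decides equality of tuples: either two of n + 1 tuples are
-- equal or they are all distinct, and the latter is excluded by Start(X, V, n + 1).
module Submission where

open import Data.Empty using (⊥-elim)
open import Data.Fin.Base as Fin using (Fin; zero; suc; _↑ˡ_; _↑ʳ_)
import Data.Fin.Properties as Finₚ
open import Data.Integer.Base as ℤ using (ℤ; +_; -[1+_]; 0ℤ; 1ℤ)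
import Data.Integer.Properties as ℤₚ
open import Data.List.Base as List using (List; []; _∷_)
open import Data.List.Membership.Propositional using (_∈_)
open import Data.List.Membership.Propositional.Properties using (∈-map⁺; ∈-map⁻; ∈-allFin; ∈-cartesianProduct⁺; ∈-filter⁺; ∈-filter⁻)
import Data.List.Properties as Listₚ
open import Data.List.Relation.Binary.Subset.Propositional using (_⊆_)
open import Data.List.Relation.Binary.Permutation.Propositional using (_↭_; ↭-refl; ↭-trans; ↭-prep; ↭-swap)
open import Data.List.Relation.Binary.Permutation.Propositional.Properties using (All-resp-↭; ↭-length)
open import Data.List.Relation.Unary.All as All using (All; []; _∷_)
import Data.List.Relation.Unary.All.Properties as Allₚ
open import Data.List.Relation.Unary.AllPairs as AllPairs using (AllPairs; []; _∷_)
import Data.List.Relation.Unary.AllPairs.Properties as AllPairsₚ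
open import Data.List.Relation.Unary.Any using (here; there)
open import Data.Nat.Base as ℕ using (ℕ; zero; suc; _+_; _*_)
import Data.Nat.Properties as ℕₚ
open import Data.Product using (_×_; _,_; proj₂; ∃; uncurry)
open import Data.Sum.Base using (_⊎_; inj₁; inj₂; map₂)
open import Data.Vec.Base as Vec using (Vec; []; _∷_; _++_)
import Data.Vec.Properties as Vecₚ
open import Function.Base using (_∘_; id; case_of_)
open import Relation.Binary.Definitions using (tri<; tri≈; tri>)
open import Relation.Binary.PropositionalEquality as ≡ using (_≡_; refl; sym; trans; cong; cong₂)
open import Relation.Binary.Structures using (IsStrictTotalOrder)
open import Relation.Nullary using (¬_; yes; no)
open import Defs

-- Recursion in the metatheory is possible because `r` is a fixed precomputed term: each numeral has
-- its own counting formula, with its own number of copies of X. The variable N of D₁ stays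
-- symbolic, so the recursion runs on a numeral that bounds N from below, not on N.
--
-- The obstacle is that neither the chain nor the sorted list can be named outside a derivation.
-- Every unfolding of D₀ is an existential elimination, which opens a larger scope, and every
-- comparison of two tuples is a disjunction elimination, which opens a branch. Both constructions
-- are therefore in continuation-passing style: the continuation receives the tuples in whatever
-- scope or context has been reached.
--
-- Std is used only through formulas that are true under all assignments. Truth puts a double
-- negation on disjunctions and existential formulas, so the facts about order and arithmetic are
-- shown by semantic reasoning, with stability where a disjunction has to be concluded from another.

module _ (L : Language) where
  open Language L
  open IsStrictTotalOrder isStrictTotalOrder using ()
    renaming (trans to ≺-trans; irrefl to ≺-irrefl; asym to ≺-asym)
  open HT# L

  -- Substitution calculus for terms and formulas

  substᴵ-cong : ∀ {i j} {τ τ′ : Fin i → ITerm j} → (∀ x → τ x ≡ τ′ x) →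
                ∀ t → substᴵ τ t ≡ substᴵ τ′ t
  substᴵ-cong e (ivar x)    = e x
  substᴵ-cong e (numeral n) = refl
  substᴵ-cong e (s ⊕ t)     = cong₂ _⊕_ (substᴵ-cong e s) (substᴵ-cong e t)
  substᴵ-cong e (s ⊖ t)     = cong₂ _⊖_ (substᴵ-cong e s) (substᴵ-cong e t)
  substᴵ-cong e (s ⊗ t)     = cong₂ _⊗_ (substᴵ-cong e s) (substᴵ-cong e t)
  substᴵ-cong e (abs t)     = cong abs (substᴵ-cong e t)

  substᴵ-id : ∀ {i} (t : ITerm i) → substᴵ ivar t ≡ t
  substᴵ-id (ivar x)    = refl
  substᴵ-id (numeral n) = refl
  substᴵ-id (s ⊕ t)     = cong₂ _⊕_ (substᴵ-id s) (substᴵ-id t)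
  substᴵ-id (s ⊖ t)     = cong₂ _⊖_ (substᴵ-id s) (substᴵ-id t)
  substᴵ-id (s ⊗ t)     = cong₂ _⊗_ (substᴵ-id s) (substᴵ-id t)
  substᴵ-id (abs t)     = cong abs (substᴵ-id t)

  substᴵ-∘ : ∀ {i j l} (τ′ : Fin j → ITerm l) (τ : Fin i → ITerm j) →
             ∀ t → substᴵ τ′ (substᴵ τ t) ≡ substᴵ (substᴵ τ′ ∘ τ) t
  substᴵ-∘ τ′ τ (ivar x)    = refl
  substᴵ-∘ τ′ τ (numeral n) = refl
  substᴵ-∘ τ′ τ (s ⊕ t)     = cong₂ _⊕_ (substᴵ-∘ τ′ τ s) (substᴵ-∘ τ′ τ t)
  substᴵ-∘ τ′ τ (s ⊖ t)     = cong₂ _⊖_ (substᴵ-∘ τ′ τ s) (substᴵ-∘ τ′ τ t)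
  substᴵ-∘ τ′ τ (s ⊗ t)     = cong₂ _⊗_ (substᴵ-∘ τ′ τ s) (substᴵ-∘ τ′ τ t)
  substᴵ-∘ τ′ τ (abs t)     = cong abs (substᴵ-∘ τ′ τ t)

  substᴳ-cong : ∀ {g h i j} {σ σ′ : Fin g → GTerm h j} {τ τ′ : Fin i → ITerm j} →
                (∀ x → σ x ≡ σ′ x) → (∀ x → τ x ≡ τ′ x) →
                ∀ t → substᴳ σ τ t ≡ substᴳ σ′ τ′ t
  substᴳ-cong d e (gvar x)  = d x
  substᴳ-cong d e (const c) = refl
  substᴳ-cong d e (int t)   = cong int (substᴵ-cong e t)

  substᴳ-id : ∀ {g i} (t : GTerm g i) → substᴳ gvar ivar t ≡ t
  substᴳ-id (gvar x)  = refl
  substᴳ-id (const c) = refl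
  substᴳ-id (int t)   = cong int (substᴵ-id t)

  substᴳ-∘ : ∀ {g g′ g″ i i′ i″}
             (σ′ : Fin g′ → GTerm g″ i″) (τ′ : Fin i′ → ITerm i″)
             (σ : Fin g → GTerm g′ i′) (τ : Fin i → ITerm i′) →
             ∀ t → substᴳ σ′ τ′ (substᴳ σ τ t) ≡ substᴳ (substᴳ σ′ τ′ ∘ σ) (substᴵ τ′ ∘ τ) t
  substᴳ-∘ σ′ τ′ σ τ (gvar x)  = refl
  substᴳ-∘ σ′ τ′ σ τ (const c) = refl
  substᴳ-∘ σ′ τ′ σ τ (int t)   = cong int (substᴵ-∘ τ′ τ t)

  wkᵍ : ∀ {g i} → GTerm g i → GTerm (suc g) i
  wkᵍ = substᴳ (λ y → gvar (suc y)) ivar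

  wkⁱ : ∀ {g i} → GTerm g i → GTerm g (suc i)
  wkⁱ = substᴳ gvar (λ y → ivar (suc y))

  wkᴵ : ∀ {i} → ITerm i → ITerm (suc i)
  wkᴵ = substᴵ (λ y → ivar (suc y))

  liftᵍ : ∀ {g h j} → (Fin g → GTerm h j) → Fin (suc g) → GTerm (suc h) j
  liftᵍ σ = extend (gvar zero) (λ x → wkᵍ (σ x))

  liftⁱ : ∀ {i j} → (Fin i → ITerm j) → Fin (suc i) → ITerm (suc j)
  liftⁱ τ = extend (ivar zero) (λ x → wkᴵ (τ x))

  extend-cong : ∀ {n} {A : Set} {a : A} {f f′ : Fin n → A} →
                (∀ x → f x ≡ f′ x) → ∀ x → extend a f x ≡ extend a f′ x
  extend-cong e zero    = refl
  extend-cong e (suc x) = e x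

  subst-cong : ∀ {P g h i j} {σ σ′ : Fin g → GTerm h j} {τ τ′ : Fin i → ITerm j} →
               (∀ x → σ x ≡ σ′ x) → (∀ x → τ x ≡ τ′ x) →
               ∀ (A : Form P g i) → subst σ τ A ≡ subst σ′ τ′ A
  subst-cong d e (s ≐ t)        = cong₂ _≐_ (substᴳ-cong d e s) (substᴳ-cong d e t)
  subst-cong d e (cmp c s t)    = cong₂ (cmp c) (substᴳ-cong d e s) (substᴳ-cong d e t)
  subst-cong d e (atom p ts us) = cong₂ (atom p) (Vecₚ.map-cong (substᴳ-cong d e) ts)
                                                 (Vecₚ.map-cong (substᴵ-cong e) us)
  subst-cong d e ⊥ᶠ             = refl
  subst-cong d e (A ∧ B)        = cong₂ _∧_ (subst-cong d e A) (subst-cong d e B)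
  subst-cong d e (A ∨ B)        = cong₂ _∨_ (subst-cong d e A) (subst-cong d e B)
  subst-cong d e (A ⇒ B)        = cong₂ _⇒_ (subst-cong d e A) (subst-cong d e B)
  subst-cong d e (∀ᵍ A)         = cong ∀ᵍ (subst-cong (extend-cong (cong wkᵍ ∘ d)) e A)
  subst-cong d e (∃ᵍ A)         = cong ∃ᵍ (subst-cong (extend-cong (cong wkᵍ ∘ d)) e A)
  subst-cong d e (∀ⁱ A)         = cong ∀ⁱ (subst-cong (cong wkⁱ ∘ d) (extend-cong (cong wkᴵ ∘ e)) A)
  subst-cong d e (∃ⁱ A)         = cong ∃ⁱ (subst-cong (cong wkⁱ ∘ d) (extend-cong (cong wkᴵ ∘ e)) A)

  liftᵍ-id : ∀ {g i} x → liftᵍ {g} {g} {i} gvar x ≡ gvar x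
  liftᵍ-id zero    = refl
  liftᵍ-id (suc x) = refl

  liftⁱ-id : ∀ {i} x → liftⁱ {i} ivar x ≡ ivar x
  liftⁱ-id zero    = refl
  liftⁱ-id (suc x) = refl

  subst-id : ∀ {P g i} (A : Form P g i) → subst gvar ivar A ≡ A
  subst-id (s ≐ t)        = cong₂ _≐_ (substᴳ-id s) (substᴳ-id t)
  subst-id (cmp c s t)    = cong₂ (cmp c) (substᴳ-id s) (substᴳ-id t)
  subst-id (atom p ts us) = cong₂ (atom p) (trans (Vecₚ.map-cong substᴳ-id ts) (Vecₚ.map-id ts))
                                           (trans (Vecₚ.map-cong substᴵ-id us) (Vecₚ.map-id us))
  subst-id ⊥ᶠ             = refl
  subst-id (A ∧ B)        = cong₂ _∧_ (subst-id A) (subst-id B)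
  subst-id (A ∨ B)        = cong₂ _∨_ (subst-id A) (subst-id B)
  subst-id (A ⇒ B)        = cong₂ _⇒_ (subst-id A) (subst-id B)
  subst-id (∀ᵍ A)         = cong ∀ᵍ (trans (subst-cong liftᵍ-id (λ _ → refl) A) (subst-id A))
  subst-id (∃ᵍ A)         = cong ∃ᵍ (trans (subst-cong liftᵍ-id (λ _ → refl) A) (subst-id A))
  subst-id (∀ⁱ A)         = cong ∀ⁱ (trans (subst-cong (λ _ → refl) liftⁱ-id A) (subst-id A))
  subst-id (∃ⁱ A)         = cong ∃ⁱ (trans (subst-cong (λ _ → refl) liftⁱ-id A) (subst-id A))

  module _ {g′ g″ i′ i″} (σ′ : Fin g′ → GTerm g″ i″) (τ′ : Fin i′ → ITerm i″) where

    liftᵍ-wkᵍ : ∀ t → substᴳ (liftᵍ σ′) τ′ (wkᵍ t) ≡ wkᵍ (substᴳ σ′ τ′ t)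
    liftᵍ-wkᵍ t = trans (substᴳ-∘ _ _ _ _ t)
      (sym (trans (substᴳ-∘ _ _ _ _ t) (substᴳ-cong (λ _ → refl) (substᴵ-id ∘ τ′) t)))

    liftⁱ-wkᴵ : ∀ t → substᴵ (liftⁱ τ′) (wkᴵ t) ≡ wkᴵ (substᴵ τ′ t)
    liftⁱ-wkᴵ t = trans (substᴵ-∘ _ _ t) (sym (substᴵ-∘ _ _ t))

    liftⁱ-wkⁱ : ∀ t → substᴳ (wkⁱ ∘ σ′) (liftⁱ τ′) (wkⁱ t) ≡ wkⁱ (substᴳ σ′ τ′ t)
    liftⁱ-wkⁱ t = trans (substᴳ-∘ _ _ _ _ t) (sym (substᴳ-∘ _ _ _ _ t))

    liftᵍ-∘ : ∀ {g} (σ : Fin g → GTerm g′ i′) x →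
              substᴳ (liftᵍ σ′) τ′ (liftᵍ σ x) ≡ liftᵍ (substᴳ σ′ τ′ ∘ σ) x
    liftᵍ-∘ σ zero    = refl
    liftᵍ-∘ σ (suc x) = liftᵍ-wkᵍ (σ x)

    liftⁱ-∘ : ∀ {i} (τ : Fin i → ITerm i′) x →
              substᴵ (liftⁱ τ′) (liftⁱ τ x) ≡ liftⁱ (substᴵ τ′ ∘ τ) x
    liftⁱ-∘ τ zero    = refl
    liftⁱ-∘ τ (suc x) = liftⁱ-wkᴵ (τ x)

  subst-∘ : ∀ {P g g′ g″ i i′ i″}
            (σ′ : Fin g′ → GTerm g″ i″) (τ′ : Fin i′ → ITerm i″)
            (σ : Fin g → GTerm g′ i′) (τ : Fin i → ITerm i′) →
            ∀ (A : Form P g i) →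
            subst σ′ τ′ (subst σ τ A) ≡ subst (substᴳ σ′ τ′ ∘ σ) (substᴵ τ′ ∘ τ) A
  subst-∘ σ′ τ′ σ τ (s ≐ t)        = cong₂ _≐_ (substᴳ-∘ σ′ τ′ σ τ s) (substᴳ-∘ σ′ τ′ σ τ t)
  subst-∘ σ′ τ′ σ τ (cmp c s t)    = cong₂ (cmp c) (substᴳ-∘ σ′ τ′ σ τ s) (substᴳ-∘ σ′ τ′ σ τ t)
  subst-∘ σ′ τ′ σ τ (atom p ts us) = cong₂ (atom p)
    (trans (sym (Vecₚ.map-∘ _ _ ts)) (Vecₚ.map-cong (substᴳ-∘ σ′ τ′ σ τ) ts))
    (trans (sym (Vecₚ.map-∘ _ _ us)) (Vecₚ.map-cong (substᴵ-∘ τ′ τ) us))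
  subst-∘ σ′ τ′ σ τ ⊥ᶠ             = refl
  subst-∘ σ′ τ′ σ τ (A ∧ B)        = cong₂ _∧_ (subst-∘ σ′ τ′ σ τ A) (subst-∘ σ′ τ′ σ τ B)
  subst-∘ σ′ τ′ σ τ (A ∨ B)        = cong₂ _∨_ (subst-∘ σ′ τ′ σ τ A) (subst-∘ σ′ τ′ σ τ B)
  subst-∘ σ′ τ′ σ τ (A ⇒ B)        = cong₂ _⇒_ (subst-∘ σ′ τ′ σ τ A) (subst-∘ σ′ τ′ σ τ B)
  subst-∘ σ′ τ′ σ τ (∀ᵍ A)         = cong ∀ᵍ (trans (subst-∘ _ _ _ _ A)
    (subst-cong (liftᵍ-∘ σ′ τ′ σ) (λ _ → refl) A))
  subst-∘ σ′ τ′ σ τ (∃ᵍ A)         = cong ∃ᵍ (trans (subst-∘ _ _ _ _ A)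
    (subst-cong (liftᵍ-∘ σ′ τ′ σ) (λ _ → refl) A))
  subst-∘ σ′ τ′ σ τ (∀ⁱ A)         = cong ∀ⁱ (trans (subst-∘ _ _ _ _ A)
    (subst-cong (liftⁱ-wkⁱ σ′ τ′ ∘ σ) (liftⁱ-∘ σ′ τ′ τ) A))
  subst-∘ σ′ τ′ σ τ (∃ⁱ A)         = cong ∃ⁱ (trans (subst-∘ _ _ _ _ A)
    (subst-cong (liftⁱ-wkⁱ σ′ τ′ ∘ σ) (liftⁱ-∘ σ′ τ′ τ) A))

  -- Fusing each composite into a single substitution leaves only agreement on variables to check,
  -- so the laws for weakening and instantiation below need no induction on formulas of their own.
  subst-∘-≡ : ∀ {P g g₁ g₂ g′ i i₁ i₂ i′}
              {σ₁ : Fin g → GTerm g₁ i₁} {τ₁ : Fin i → ITerm i₁}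
              {σ₁′ : Fin g₁ → GTerm g′ i′} {τ₁′ : Fin i₁ → ITerm i′}
              {σ₂ : Fin g → GTerm g₂ i₂} {τ₂ : Fin i → ITerm i₂}
              {σ₂′ : Fin g₂ → GTerm g′ i′} {τ₂′ : Fin i₂ → ITerm i′} →
              (∀ x → substᴳ σ₁′ τ₁′ (σ₁ x) ≡ substᴳ σ₂′ τ₂′ (σ₂ x)) →
              (∀ x → substᴵ τ₁′ (τ₁ x) ≡ substᴵ τ₂′ (τ₂ x)) →
              ∀ (A : Form P g i) →
              subst σ₁′ τ₁′ (subst σ₁ τ₁ A) ≡ subst σ₂′ τ₂′ (subst σ₂ τ₂ A)
  subst-∘-≡ d e A = trans (subst-∘ _ _ _ _ A) (trans (subst-cong d e A) (sym (subst-∘ _ _ _ _ A)))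

  subst-weakenᵍ : ∀ {P g h i j} (σ : Fin g → GTerm h j) (τ : Fin i → ITerm j) (A : Form P g i) →
                  subst (liftᵍ σ) τ (weakenᵍ A) ≡ weakenᵍ (subst σ τ A)
  subst-weakenᵍ σ τ = subst-∘-≡ (λ _ → refl) (sym ∘ substᴵ-id ∘ τ)

  subst-weakenⁱ : ∀ {P g h i j} (σ : Fin g → GTerm h j) (τ : Fin i → ITerm j) (A : Form P g i) →
                  subst (wkⁱ ∘ σ) (liftⁱ τ) (weakenⁱ A) ≡ weakenⁱ (subst σ τ A)
  subst-weakenⁱ σ τ = subst-∘-≡ (λ _ → refl) (λ _ → refl)

  subst-[]ᵍ : ∀ {P g h i j} (σ : Fin g → GTerm h j) (τ : Fin i → ITerm j) (A : Form P (suc g) i) t →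
              subst (liftᵍ σ) τ A [ substᴳ σ τ t ]ᵍ ≡ subst σ τ (A [ t ]ᵍ)
  subst-[]ᵍ σ τ A t = subst-∘-≡
    (λ { zero → refl
       ; (suc x) → trans (substᴳ-∘ _ _ _ _ (σ x)) (substᴳ-id (σ x)) })
    (substᴵ-id ∘ τ) A

  subst-[]ⁱ : ∀ {P g h i j} (σ : Fin g → GTerm h j) (τ : Fin i → ITerm j) (A : Form P g (suc i)) t →
              subst (wkⁱ ∘ σ) (liftⁱ τ) A [ substᴵ τ t ]ⁱ ≡ subst σ τ (A [ t ]ⁱ)
  subst-[]ⁱ σ τ A t = subst-∘-≡
    (λ x → trans (substᴳ-∘ _ _ _ _ (σ x)) (substᴳ-id (σ x)))
    (λ { zero → refl
       ; (suc x) → trans (substᴵ-∘ _ _ (τ x)) (substᴵ-id (τ x)) }) A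

  -- Admissibility of substitution and weakening

  cast : ∀ {g i} {Γ : List (Form σ₂ g i)} {A B} → A ≡ B → Γ ⊢ A → Γ ⊢ B
  cast refl d = d

  -- Asking for membership and not for equality of lists lets one relation carry a change of scope,
  -- the addition of hypotheses and their reordering.
  _⊑[_,_]_ : ∀ {g h i j} → List (Form σ₂ g i) → (Fin g → GTerm h j) → (Fin i → ITerm j) →
             List (Form σ₂ h j) → Set
  Γ ⊑[ σ , τ ] Δ = ∀ {A} → A ∈ Γ → subst σ τ A ∈ Δ

  ⊑-∷ : ∀ {g h i j} {σ : Fin g → GTerm h j} {τ : Fin i → ITerm j} {Γ Δ A} →
        Γ ⊑[ σ , τ ] Δ → (A ∷ Γ) ⊑[ σ , τ ] (subst σ τ A ∷ Δ)
  ⊑-∷ ι (here refl) = here refl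
  ⊑-∷ ι (there p)   = there (ι p)

  ⊑-liftᵍ : ∀ {g h i j} {σ : Fin g → GTerm h j} {τ : Fin i → ITerm j} {Γ Δ} →
            Γ ⊑[ σ , τ ] Δ → List.map weakenᵍ Γ ⊑[ liftᵍ σ , τ ] List.map weakenᵍ Δ
  ⊑-liftᵍ {σ = σ} {τ} ι p with ∈-map⁻ weakenᵍ p
  ... | A , q , refl = ≡.subst (_∈ _) (sym (subst-weakenᵍ σ τ A)) (∈-map⁺ weakenᵍ (ι q))

  ⊑-liftⁱ : ∀ {g h i j} {σ : Fin g → GTerm h j} {τ : Fin i → ITerm j} {Γ Δ} →
            Γ ⊑[ σ , τ ] Δ → List.map weakenⁱ Γ ⊑[ wkⁱ ∘ σ , liftⁱ τ ] List.map weakenⁱ Δ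
  ⊑-liftⁱ {σ = σ} {τ} ι p with ∈-map⁻ weakenⁱ p
  ... | A , q , refl = ≡.subst (_∈ _) (sym (subst-weakenⁱ σ τ A)) (∈-map⁺ weakenⁱ (ι q))

  substitute : ∀ {g h i j} {σ : Fin g → GTerm h j} {τ : Fin i → ITerm j} {Γ Δ A} →
               Γ ⊑[ σ , τ ] Δ → Γ ⊢ A → Δ ⊢ subst σ τ A
  substitute ι (hyp p)         = hyp (ι p)
  substitute ι (⊥E d)          = ⊥E (substitute ι d)
  substitute ι (∧I d e)        = ∧I (substitute ι d) (substitute ι e)
  substitute ι (∧E₁ d)         = ∧E₁ (substitute ι d)
  substitute ι (∧E₂ d)         = ∧E₂ (substitute ι d)
  substitute ι (∨I₁ d)         = ∨I₁ (substitute ι d)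
  substitute ι (∨I₂ d)         = ∨I₂ (substitute ι d)
  substitute ι (∨E d e f)      = ∨E (substitute ι d) (substitute (⊑-∷ ι) e) (substitute (⊑-∷ ι) f)
  substitute ι (⇒I d)          = ⇒I (substitute (⊑-∷ ι) d)
  substitute ι (⇒E d e)        = ⇒E (substitute ι d) (substitute ι e)
  substitute ι (∀ᵍI d)         = ∀ᵍI (substitute (⊑-liftᵍ ι) d)
  substitute ι (∀ᵍE {A} t d)   = cast (subst-[]ᵍ _ _ A t) (∀ᵍE _ (substitute ι d))
  substitute ι (∃ᵍI {A} t d)   = ∃ᵍI _ (cast (sym (subst-[]ᵍ _ _ A t)) (substitute ι d))
  substitute ι (∃ᵍE {C = C} d e) =
    ∃ᵍE (substitute ι d) (cast (subst-weakenᵍ _ _ C) (substitute (⊑-∷ (⊑-liftᵍ ι)) e))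
  substitute ι (∀ⁱI d)         = ∀ⁱI (substitute (⊑-liftⁱ ι) d)
  substitute ι (∀ⁱE {A} t d)   = cast (subst-[]ⁱ _ _ A t) (∀ⁱE _ (substitute ι d))
  substitute ι (∃ⁱI {A} t d)   = ∃ⁱI _ (cast (sym (subst-[]ⁱ _ _ A t)) (substitute ι d))
  substitute ι (∃ⁱE {C = C} d e) =
    ∃ⁱE (substitute ι d) (cast (subst-weakenⁱ _ _ C) (substitute (⊑-∷ (⊑-liftⁱ ι)) e))
  substitute ι (≐I t)          = ≐I _
  substitute ι (≐Eᵍ A {s} {t} d e) =
    cast (subst-[]ᵍ _ _ A t) (≐Eᵍ _ (substitute ι d) (cast (sym (subst-[]ᵍ _ _ A s)) (substitute ι e)))
  substitute ι (≐Eⁱ A {s} {t} d e) =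
    cast (subst-[]ⁱ _ _ A t) (≐Eⁱ _ (substitute ι d) (cast (sym (subst-[]ⁱ _ _ A s)) (substitute ι e)))
  substitute ι (hosoi A B)     = hosoi _ _
  substitute {σ = σ} {τ} ι (sqhtᵍ A) = cast
    (cong (λ B → ∃ᵍ (subst (liftᵍ σ) τ A ⇒ B)) (sym (subst-weakenᵍ σ τ (∀ᵍ A)))) (sqhtᵍ _)
  substitute {σ = σ} {τ} ι (sqhtⁱ A) = cast
    (cong (λ B → ∃ⁱ (subst (wkⁱ ∘ σ) (liftⁱ τ) A ⇒ B)) (sym (subst-weakenⁱ σ τ (∀ⁱ A)))) (sqhtⁱ _)
  -- An embedded sentence has no free variables, so the two substitutions agree vacuously.
  substitute ι (axiom {A} a)   = cast
    (sym (trans (subst-∘ _ _ _ _ A) (subst-cong (λ ()) (λ ()) A))) (axiom a)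

  weaken : ∀ {g i} {Γ Δ : List (Form σ₂ g i)} {A} → Γ ⊆ Δ → Γ ⊢ A → Δ ⊢ A
  weaken {A = A} ι d = cast (subst-id A)
    (substitute (λ {B} p → ≡.subst (_∈ _) (sym (subst-id B)) (ι p)) d)

  -- Iterated quantifiers

  liftᵍ* : ∀ n {g h j} → (Fin g → GTerm h j) → Fin (n + g) → GTerm (n + h) j
  liftᵍ* zero    σ = σ
  liftᵍ* (suc n) σ = liftᵍ (liftᵍ* n σ)

  wkᵍ* : ∀ n {g i} → GTerm g i → GTerm (n + g) i
  wkᵍ* n = substᴳ (λ x → gvar (n ↑ʳ x)) ivar

  weakenᵍ* : ∀ n {g i} → Form σ₂ g i → Form σ₂ (n + g) i
  weakenᵍ* n = subst (λ x → gvar (n ↑ʳ x)) ivar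

  instᵍ : ∀ n {g i} → (Fin n → GTerm g i) → Fin (n + g) → GTerm g i
  instᵍ zero    ts = gvar
  instᵍ (suc n) ts = extend (ts zero) (instᵍ n (ts ∘ suc))

  liftᵍ*-↑ˡ : ∀ n {g h j} (σ : Fin g → GTerm h j) (x : Fin n) → liftᵍ* n σ (x ↑ˡ g) ≡ gvar (x ↑ˡ h)
  liftᵍ*-↑ˡ (suc n) σ zero    = refl
  liftᵍ*-↑ˡ (suc n) σ (suc x) = cong wkᵍ (liftᵍ*-↑ˡ n σ x)

  liftᵍ*-↑ʳ : ∀ n {g h j} (σ : Fin g → GTerm h j) (x : Fin g) → liftᵍ* n σ (n ↑ʳ x) ≡ wkᵍ* n (σ x)
  liftᵍ*-↑ʳ zero    σ x = sym (substᴳ-id (σ x))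
  liftᵍ*-↑ʳ (suc n) σ x = trans (cong wkᵍ (liftᵍ*-↑ʳ n σ x)) (substᴳ-∘ _ _ _ _ (σ x))

  instᵍ-↑ˡ : ∀ n {g i} (ts : Fin n → GTerm g i) x → instᵍ n ts (x ↑ˡ g) ≡ ts x
  instᵍ-↑ˡ (suc n) ts zero    = refl
  instᵍ-↑ˡ (suc n) ts (suc x) = instᵍ-↑ˡ n (ts ∘ suc) x

  instᵍ-↑ʳ : ∀ n {g i} (ts : Fin n → GTerm g i) x → instᵍ n ts (n ↑ʳ x) ≡ gvar x
  instᵍ-↑ʳ zero    ts x = refl
  instᵍ-↑ʳ (suc n) ts x = instᵍ-↑ʳ n (ts ∘ suc) x

  subst-∃ᵍ* : ∀ n {P g h i j} (σ : Fin g → GTerm h j) (τ : Fin i → ITerm j) (A : Form P (n + g) i) →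
              subst σ τ (∃ᵍ* n A) ≡ ∃ᵍ* n (subst (liftᵍ* n σ) τ A)
  subst-∃ᵍ* zero    σ τ A = refl
  subst-∃ᵍ* (suc n) σ τ A = subst-∃ᵍ* n σ τ (∃ᵍ A)

  subst-∀ᵍ* : ∀ n {P g h i j} (σ : Fin g → GTerm h j) (τ : Fin i → ITerm j) (A : Form P (n + g) i) →
              subst σ τ (∀ᵍ* n A) ≡ ∀ᵍ* n (subst (liftᵍ* n σ) τ A)
  subst-∀ᵍ* zero    σ τ A = refl
  subst-∀ᵍ* (suc n) σ τ A = subst-∀ᵍ* n σ τ (∀ᵍ A)

  -- `∀ᵍ*` and `∃ᵍ*` put the variable `zero` innermost: the outer `n` variables are instantiated
  -- first, under a lift, and the innermost one last. The composite is the simultaneous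
  -- instantiation.
  instᵍ-step : ∀ {n g i} (ts : Fin (suc n) → GTerm g i) (A : Form σ₂ (suc n + g) i) →
               subst (liftᵍ (instᵍ n (ts ∘ suc))) ivar A [ ts zero ]ᵍ ≡ subst (instᵍ (suc n) ts) ivar A
  instᵍ-step {n} ts A = trans (subst-∘ _ _ _ _ A) (subst-cong
    (λ { zero → refl ; (suc x) → trans (substᴳ-∘ _ _ _ _ (instᵍ n (ts ∘ suc) x)) (substᴳ-id _) })
    (λ _ → refl) A)

  ∃ᵍ*I : ∀ n {g i} {Γ : List (Form σ₂ g i)} {A} (ts : Fin n → GTerm g i) →
         Γ ⊢ subst (instᵍ n ts) ivar A → Γ ⊢ ∃ᵍ* n A
  ∃ᵍ*I zero    {A = A} ts d = cast (subst-id A) d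
  ∃ᵍ*I (suc n) {A = A} ts d = ∃ᵍ*I n (ts ∘ suc) (∃ᵍI (ts zero) (cast (sym (instᵍ-step ts A)) d))

  ∀ᵍ*E : ∀ n {g i} {Γ : List (Form σ₂ g i)} {A} (ts : Fin n → GTerm g i) →
         Γ ⊢ ∀ᵍ* n A → Γ ⊢ subst (instᵍ n ts) ivar A
  ∀ᵍ*E zero    {A = A} ts d = cast (sym (subst-id A)) d
  ∀ᵍ*E (suc n) {A = A} ts d = cast (instᵍ-step ts A) (∀ᵍE (ts zero) (∀ᵍ*E n (ts ∘ suc) d))

  weakenᵍ*-suc : ∀ n {g i} (A : Form σ₂ g i) → weakenᵍ (weakenᵍ* n A) ≡ weakenᵍ* (suc n) A
  weakenᵍ*-suc n = subst-∘ _ _ _ _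

  map-weakenᵍ*-suc : ∀ n {g i} (Γ : List (Form σ₂ g i)) →
                     List.map (weakenᵍ* (suc n)) Γ ⊆ List.map weakenᵍ (List.map (weakenᵍ* n) Γ)
  map-weakenᵍ*-suc n Γ p with ∈-map⁻ (weakenᵍ* (suc n)) p
  ... | A , q , refl = ≡.subst (_∈ _) (weakenᵍ*-suc n A) (∈-map⁺ weakenᵍ (∈-map⁺ (weakenᵍ* n) q))

  map-weakenᵍ*-zero : ∀ {g i} (Γ : List (Form σ₂ g i)) → List.map (weakenᵍ* zero) Γ ⊆ Γ
  map-weakenᵍ*-zero Γ p with ∈-map⁻ (weakenᵍ* zero) p
  ... | A , q , refl = ≡.subst (_∈ Γ) (sym (subst-id A)) q

  ∷⁺ : ∀ {g i} {Γ Δ : List (Form σ₂ g i)} {A} → Γ ⊆ Δ → (A ∷ Γ) ⊆ (A ∷ Δ)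
  ∷⁺ ι (here e)  = here e
  ∷⁺ ι (there p) = there (ι p)

  ∃ᵍ*E : ∀ n {g i} {Γ : List (Form σ₂ g i)} {A C} →
         Γ ⊢ ∃ᵍ* n A → A ∷ List.map (weakenᵍ* n) Γ ⊢ weakenᵍ* n C → Γ ⊢ C
  ∃ᵍ*E zero    {Γ = Γ} {C = C} d e =
    -- Without quantifiers the elimination is a cut; `weakenᵍ* zero` is the identity only up to a
    -- proved equation.
    ⇒E (⇒I (cast (subst-id C) (weaken (∷⁺ (map-weakenᵍ*-zero Γ)) e))) d
  ∃ᵍ*E (suc n) {Γ = Γ} {C = C} d e = ∃ᵍ*E n d (∃ᵍE (hyp (here refl))
    (cast (sym (weakenᵍ*-suc n C)) (weaken (∷⁺ (there ∘ map-weakenᵍ*-suc n Γ)) e)))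

  ∀ᵍ*I : ∀ n {g i} {Γ : List (Form σ₂ g i)} {A} → List.map (weakenᵍ* n) Γ ⊢ A → Γ ⊢ ∀ᵍ* n A
  ∀ᵍ*I zero    {Γ = Γ} d = weaken (map-weakenᵍ*-zero Γ) d
  ∀ᵍ*I (suc n) {Γ = Γ} d = ∀ᵍ*I n (∀ᵍI (weaken (map-weakenᵍ*-suc n Γ) d))

  closeI : ∀ {g i} {A : Form σ₂ g i} → [] ⊢ A → [] ⊢ close A
  closeI {zero}  {zero}  d = d
  closeI {suc g} {zero}  d = closeI (∀ᵍI d)
  closeI {i = suc i}     d = closeI (∀ⁱI d)

  -- `close A` has no free variables, so it does not matter which substitution carries it into the
  -- scope of `Γ`. With `σ₀` and `τ₀` arbitrary, the embedding made by `axiom` fits, and the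
  -- recursion can peel off one quantifier at a time.
  closeE : ∀ {g i h j} {Γ : List (Form σ₂ h j)} {A : Form σ₂ g i} {σ₀ τ₀} →
           Γ ⊢ subst σ₀ τ₀ (close A) → ∀ σ τ → Γ ⊢ subst σ τ A
  closeE {zero}  {zero} {A = A} d σ τ = cast (subst-cong (λ ()) (λ ()) A) d
  closeE {suc g} {zero} {A = A} d σ τ = cast
    (trans (subst-∘ _ _ _ _ A) (subst-cong
      (λ { zero → refl ; (suc x) → trans (substᴳ-∘ _ _ _ _ (σ (suc x))) (substᴳ-id _) }) (λ ()) A))
    (∀ᵍE (σ zero) (closeE {A = ∀ᵍ A} d (σ ∘ suc) τ))
  closeE {g} {suc i} {A = A} d σ τ = cast
    (trans (subst-∘ _ _ _ _ A) (subst-cong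
      (λ x → trans (substᴳ-∘ _ _ _ _ (σ x)) (substᴳ-id _))
      (λ { zero → refl ; (suc x) → trans (substᴵ-∘ _ _ (τ (suc x))) (substᴵ-id _) }) A))
    (∀ⁱE (τ zero) (closeE {A = ∀ⁱ A} d σ (τ ∘ suc)))

  -- Truth in the standard interpretation

  noPred : ∀ {a b} → NoPred a b → σ₂ a b
  noPred ()

  fromStd : ∀ {g i} → Form NoPred g i → Form σ₂ g i
  fromStd = mapPred {NoPred} {σ₂} noPred

  -- Formulas over `NoPred` have no atoms, so `mapPred` never applies `f`. Absurd functions need not
  -- be definitionally equal; this identifies the one inside `ax-std` with `noPred`.
  mapPred-fromStd : ∀ {g i} (f : ∀ {a b} → NoPred a b → σ₂ a b) (A : Form NoPred g i) →
                   mapPred f A ≡ fromStd A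
  mapPred-fromStd f (s ≐ t)     = refl
  mapPred-fromStd f (cmp c s t) = refl
  mapPred-fromStd f (atom () _ _)
  mapPred-fromStd f ⊥ᶠ          = refl
  mapPred-fromStd f (A ∧ B)     = cong₂ _∧_ (mapPred-fromStd f A) (mapPred-fromStd f B)
  mapPred-fromStd f (A ∨ B)     = cong₂ _∨_ (mapPred-fromStd f A) (mapPred-fromStd f B)
  mapPred-fromStd f (A ⇒ B)     = cong₂ _⇒_ (mapPred-fromStd f A) (mapPred-fromStd f B)
  mapPred-fromStd f (∀ᵍ A)      = cong ∀ᵍ (mapPred-fromStd f A)
  mapPred-fromStd f (∃ᵍ A)      = cong ∃ᵍ (mapPred-fromStd f A)
  mapPred-fromStd f (∀ⁱ A)      = cong ∀ⁱ (mapPred-fromStd f A)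
  mapPred-fromStd f (∃ⁱ A)      = cong ∃ⁱ (mapPred-fromStd f A)

  fromStd-close : ∀ {g i} (A : Form NoPred g i) →
                  fromStd (close A) ≡ close (fromStd A)
  fromStd-close {zero}  {zero} A = refl
  fromStd-close {suc g} {zero} A = fromStd-close (∀ᵍ A)
  fromStd-close {i = suc i}    A = fromStd-close (∀ⁱ A)

  close-true : ∀ {g i} (A : Form NoPred g i) → (∀ μ ν → ⟦ A ⟧ μ ν) → True (close A)
  close-true {zero}  {zero} A t = t _ _
  close-true {suc g} {zero} A t = close-true (∀ᵍ A) (λ μ ν x → t (extend x μ) ν)
  close-true {i = suc i}    A t = close-true (∀ⁱ A) (λ μ ν n → t μ (extend n ν))

  -- Validity under every assignment makes the universal closure true, hence an axiom, which is then
  -- instantiated at the variables themselves. All facts about order and arithmetic enter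
  -- derivations here.
  std : ∀ {g i} {Γ : List (Form σ₂ g i)} (A : Form NoPred g i) →
        (∀ μ ν → ⟦ A ⟧ μ ν) → Γ ⊢ fromStd A
  std A t = cast (subst-id _)
    (closeE {A = fromStd A}
      (cast (cong embed (trans (mapPred-fromStd _ (close A)) (fromStd-close A)))
            (axiom (ax-std (close A) (close-true A t))))
      gvar ivar)

  module _ {g i} {X : Set} (f : X → Form NoPred g i) {μ : Fin g → Term} {ν : Fin i → ℤ} where

    ⋀-true⁺ : ∀ l → (∀ {x} → x ∈ l → ⟦ f x ⟧ μ ν) → ⟦ ⋀ (List.map f l) ⟧ μ ν
    ⋀-true⁺ []      t = id
    ⋀-true⁺ (x ∷ l) t = t (here refl) , ⋀-true⁺ l (t ∘ there)

    ⋀-true⁻ : ∀ {l} → ⟦ ⋀ (List.map f l) ⟧ μ ν → ∀ {x} → x ∈ l → ⟦ f x ⟧ μ ν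
    ⋀-true⁻ (t , ts) (here refl) = t
    ⋀-true⁻ (t , ts) (there p)   = ⋀-true⁻ ts p

    ⋁-true⁺ : ∀ {l x} → x ∈ l → ⟦ f x ⟧ μ ν → ⟦ ⋁ (List.map f l) ⟧ μ ν
    ⋁-true⁺ (here refl) t k = k (inj₁ t)
    ⋁-true⁺ (there p)   t k = k (inj₂ (⋁-true⁺ p t))

    ⋁-true⁻ : ∀ l → (∀ {x} → x ∈ l → ¬ ⟦ f x ⟧ μ ν) → ¬ ⟦ ⋁ (List.map f l) ⟧ μ ν
    ⋁-true⁻ []      k = id
    ⋁-true⁻ (x ∷ l) k t = t λ { (inj₁ u) → k (here refl) u ; (inj₂ u) → ⋁-true⁻ l (k ∘ there) u }

    -- The truth of a nonempty disjunction is a double negation and that of the empty one is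
    -- absurdity; both are stable.
    ⋁-stable : ∀ l → ¬ ¬ ⟦ ⋁ (List.map f l) ⟧ μ ν → ⟦ ⋁ (List.map f l) ⟧ μ ν
    ⋁-stable []      t   = t id
    ⋁-stable (x ∷ l) t k = t λ u → u k

  module _ {P Q : ℕ → ℕ → Set} {g g′ i i′} (h : Form P g i → Form Q g′ i′) {X : Set} where

    -- Stated for any `h` that commutes with the connectives, since it serves both `fromStd` and
    -- `subst`.
    ⋀-map : h ⊤ᶠ ≡ ⊤ᶠ → (∀ A B → h (A ∧ B) ≡ h A ∧ h B) →
            ∀ (f : X → Form P g i) l → h (⋀ (List.map f l)) ≡ ⋀ (List.map (h ∘ f) l)
    ⋀-map e c f []      = e
    ⋀-map e c f (x ∷ l) = trans (c _ _) (cong (h (f x) ∧_) (⋀-map e c f l))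

    ⋁-map : h ⊥ᶠ ≡ ⊥ᶠ → (∀ A B → h (A ∨ B) ≡ h A ∨ h B) →
            ∀ (f : X → Form P g i) l → h (⋁ (List.map f l)) ≡ ⋁ (List.map (h ∘ f) l)
    ⋁-map e c f []      = e
    ⋁-map e c f (x ∷ l) = trans (c _ _) (cong (h (f x) ∨_) (⋁-map e c f l))

  -- Lexicographic order

  predecessors : ∀ {m} → Fin m → List (Fin m)
  predecessors {m} l = List.filter (Finₚ._<? l) (List.allFin m)

  eqAt : ∀ {P g i m} → Vec (GTerm g i) m → Vec (GTerm g i) m → Fin m → Form P g i
  eqAt ts us l = Vec.lookup ts l ≐ Vec.lookup us l

  -- Definitionally the disjunct local to `_<lex_`, which cannot be named outside that definition.
  lexAt : ∀ {P g i m} → Vec (GTerm g i) m → Vec (GTerm g i) m → Fin m → Form P g i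
  lexAt ts us l = ⋀ (List.map (eqAt ts us) (predecessors l)) ∧ cmp < (Vec.lookup ts l) (Vec.lookup us l)

  module _ {g i m} (ts us : Vec (GTerm g i) m) where

    fromStd-≐* : fromStd (ts ≐* us) ≡ ts ≐* us
    fromStd-≐* = ⋀-map (fromStd) refl (λ _ _ → refl) (eqAt ts us) (List.allFin m)

    fromStd-<lex : fromStd (ts <lex us) ≡ ts <lex us
    fromStd-<lex = trans (⋁-map (fromStd) refl (λ _ _ → refl) (lexAt ts us) (List.allFin m))
      (cong ⋁ (Listₚ.map-cong
        (λ l → cong (_∧ cmp < (Vec.lookup ts l) (Vec.lookup us l))
                    (⋀-map (fromStd) refl (λ _ _ → refl) (eqAt ts us) (predecessors l)))
        (List.allFin m)))

  module _ {P : ℕ → ℕ → Set} {g h i j} (σ : Fin g → GTerm h j) (τ : Fin i → ITerm j)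
           {m} (ts us : Vec (GTerm g i) m) where
    private
      eqAt-subst : ∀ l → subst σ τ (eqAt {P} ts us l) ≡
                         eqAt (Vec.map (substᴳ σ τ) ts) (Vec.map (substᴳ σ τ) us) l
      eqAt-subst l = sym (cong₂ _≐_ (Vecₚ.lookup-map l _ ts) (Vecₚ.lookup-map l _ us))

    subst-≐* : subst {P} σ τ (ts ≐* us) ≡ Vec.map (substᴳ σ τ) ts ≐* Vec.map (substᴳ σ τ) us
    subst-≐* = trans (⋀-map (subst σ τ) refl (λ _ _ → refl) (eqAt ts us) (List.allFin m))
      (cong ⋀ (Listₚ.map-cong eqAt-subst (List.allFin m)))

    subst-<lex : subst {P} σ τ (ts <lex us) ≡ Vec.map (substᴳ σ τ) ts <lex Vec.map (substᴳ σ τ) us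
    subst-<lex = trans (⋁-map (subst σ τ) refl (λ _ _ → refl) (lexAt ts us) (List.allFin m))
      (cong ⋁ (Listₚ.map-cong
        (λ l → cong₂ _∧_
          (trans (⋀-map (subst σ τ) refl (λ _ _ → refl) (eqAt ts us) (predecessors l))
                 (cong ⋀ (Listₚ.map-cong eqAt-subst (predecessors l))))
          (sym (cong₂ (cmp <) (Vecₚ.lookup-map l _ ts) (Vecₚ.lookup-map l _ us))))
        (List.allFin m)))

  Lex : ∀ {m} → (Fin m → Term) → (Fin m → Term) → Set
  Lex x y = ∃ λ l → (∀ {j} → j Fin.< l → x j ≡ y j) × x l ≺ y l

  -- The smaller of the two positions of first difference decides: before it all three tuples agree,
  -- and at it one step is strict while the other is strict or an equality.
  Lex-trans : ∀ {m} {x y z : Fin m → Term} → Lex x y → Lex y z → Lex x z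
  Lex-trans (l , d , p) (l′ , e , q) with Finₚ.<-cmp l l′
  ... | tri< l<l′ _ _ = l , (λ j<l → trans (d j<l) (e (Finₚ.<-trans j<l l<l′))) ,
                        ≡.subst (_ ≺_) (e l<l′) p
  ... | tri≈ _ refl _ = l , (λ j<l → trans (d j<l) (e j<l)) , ≺-trans p q
  ... | tri> _ _ l′<l = l′ , (λ j<l′ → trans (d (Finₚ.<-trans j<l′ l′<l)) (e j<l′)) ,
                        ≡.subst (_≺ _) (sym (d l′<l)) q

  Lex-∷ : ∀ {m} {x y : Fin (suc m) → Term} → x zero ≡ y zero → Lex (x ∘ suc) (y ∘ suc) → Lex x y
  Lex-∷ e (l , d , p) = suc l , (λ { {zero} _ → e ; {suc j} (ℕ.s≤s j<l) → d j<l }) , p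

  Lex-connex : ∀ {m} (x y : Fin m → Term) → Lex x y ⊎ (∀ j → x j ≡ y j) ⊎ Lex y x
  Lex-connex {zero}  x y = inj₂ (inj₁ λ ())
  Lex-connex {suc m} x y with compare (x zero) (y zero)
  ... | tri< p _ _ = inj₁ (zero , (λ ()) , p)
  ... | tri> _ _ p = inj₂ (inj₂ (zero , (λ ()) , p))
  ... | tri≈ _ e _ with Lex-connex (x ∘ suc) (y ∘ suc)
  ...   | inj₁ p        = inj₁ (Lex-∷ e p)
  ...   | inj₂ (inj₁ d) = inj₂ (inj₁ λ { zero → e ; (suc j) → d j })
  ...   | inj₂ (inj₂ p) = inj₂ (inj₂ (Lex-∷ (sym e) p))

  module _ {g i m} (ts us : Vec (GTerm g i) m) {μ : Fin g → Term} {ν : Fin i → ℤ} where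
    private
      x y : Fin m → Term
      x = evalᴳ μ ν ∘ Vec.lookup ts
      y = evalᴳ μ ν ∘ Vec.lookup us

    ≐*-true⁺ : (∀ j → x j ≡ y j) → ⟦ ts ≐* us ⟧ μ ν
    ≐*-true⁺ e = ⋀-true⁺ (eqAt ts us) (List.allFin m) (λ {j} _ → e j)

    ≐*-true⁻ : ⟦ ts ≐* us ⟧ μ ν → ∀ j → x j ≡ y j
    ≐*-true⁻ t j = ⋀-true⁻ (eqAt ts us) t (∈-allFin j)

    <lex-true⁺ : Lex x y → ⟦ ts <lex us ⟧ μ ν
    <lex-true⁺ (l , e , p) = ⋁-true⁺ (lexAt ts us) (∈-allFin l)
      (⋀-true⁺ (eqAt ts us) _ (λ q → e (proj₂ (∈-filter⁻ (Finₚ._<? l) {xs = List.allFin m} q))) , p)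

    -- The position of first difference is obtained only up to double negation. This is enough: the
    -- uses below aim at absurdity or at another `<lex`, which is stable.
    <lex-true⁻ : ⟦ ts <lex us ⟧ μ ν → ¬ ¬ Lex x y
    <lex-true⁻ t k = ⋁-true⁻ (lexAt ts us) (List.allFin m)
      (λ {l} _ (e , p) → k (l , (λ {j} j<l →
         ⋀-true⁻ (eqAt ts us) e (∈-filter⁺ (Finₚ._<? l) (∈-allFin j) j<l)) , p)) t

    <lex-stable : ¬ ¬ ⟦ ts <lex us ⟧ μ ν → ⟦ ts <lex us ⟧ μ ν
    <lex-stable = ⋁-stable (lexAt ts us) (List.allFin m)

  module _ {g i} {Γ : List (Form σ₂ g i)} {m} (ts us : Vec (GTerm g i) m) where

    <lex-connex : Γ ⊢ ts <lex us ∨ ts ≐* us ∨ us <lex ts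
    <lex-connex = cast
      (cong₂ _∨_ (fromStd-<lex ts us) (cong₂ _∨_ (fromStd-≐* ts us) (fromStd-<lex us ts)))
      (std (ts <lex us ∨ ts ≐* us ∨ us <lex ts) λ μ ν k → case Lex-connex _ _ of λ where
        (inj₁ p)        → k (inj₁ (<lex-true⁺ ts us p))
        (inj₂ (inj₁ e)) → k (inj₂ λ k′ → k′ (inj₁ (≐*-true⁺ ts us e)))
        (inj₂ (inj₂ p)) → k (inj₂ λ k′ → k′ (inj₂ (<lex-true⁺ us ts p))))

    -- Truth of a disjunction carries a double negation, so the intuitionistic proof of doubly
    -- negated excluded middle suffices.
    ≐*-dec : Γ ⊢ ts ≐* us ∨ ~ (ts ≐* us)
    ≐*-dec = cast (cong (λ A → A ∨ ~ A) (fromStd-≐* ts us))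
      (std (ts ≐* us ∨ ~ (ts ≐* us)) λ μ ν k → k (inj₂ λ e → k (inj₁ e)))

    <lex⇒≠ : Γ ⊢ ts <lex us → Γ ⊢ ~ (ts ≐* us)
    <lex⇒≠ = ⇒E (cast (cong₂ (λ A B → A ⇒ ~ B) (fromStd-<lex ts us) (fromStd-≐* ts us))
      (std (ts <lex us ⇒ ~ (ts ≐* us)) λ μ ν p e →
        <lex-true⁻ ts us p λ (l , _ , q) → ≺-irrefl (≐*-true⁻ ts us e l) q))

    <lex-trans : ∀ vs → Γ ⊢ ts <lex us → Γ ⊢ us <lex vs → Γ ⊢ ts <lex vs
    <lex-trans vs d = ⇒E (⇒E (cast
      (cong₂ _⇒_ (fromStd-<lex ts us) (cong₂ _⇒_ (fromStd-<lex us vs) (fromStd-<lex ts vs)))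
      (std (ts <lex us ⇒ us <lex vs ⇒ ts <lex vs) λ μ ν p q → <lex-stable ts vs λ k →
        <lex-true⁻ ts us p λ p′ → <lex-true⁻ us vs q λ q′ → k (<lex-true⁺ ts vs (Lex-trans p′ q′)))) d)

  -- Integer arithmetic

  -- `num-mono` gives the other direction only; this one follows by trichotomy of the integers,
  -- since the other two cases contradict irreflexivity and asymmetry.
  num-≺⁻ : ∀ {a b} → num a ≺ num b → a ℤ.< b
  num-≺⁻ {a} {b} p with ℤₚ.<-cmp a b
  ... | tri< a<b _ _  = a<b
  ... | tri≈ _ refl _ = ⊥-elim (≺-irrefl refl p)
  ... | tri> _ _ b<a  = ⊥-elim (≺-asym p (num-mono b<a))

  num-≤⁺ : ∀ {a b} → a ℤ.≤ b → compares ≤ (num a) (num b)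
  num-≤⁺ {a} {b} a≤b with ℤₚ.<-cmp a b
  ... | tri< a<b _ _  = inj₁ (num-mono a<b)
  ... | tri≈ _ refl _ = inj₂ refl
  ... | tri> _ _ b<a  = ⊥-elim (ℤₚ.≤⇒≯ a≤b b<a)

  num-≥⁺ : ∀ {a b} → b ℤ.≤ a → compares ≥ (num a) (num b)
  num-≥⁺ {a} {b} b≤a = map₂ sym (num-≤⁺ b≤a)

  num-≥⁻ : ∀ {a b} → compares ≥ (num a) (num b) → b ℤ.≤ a
  num-≥⁻ (inj₁ p)    = ℤₚ.<⇒≤ (num-≺⁻ p)
  num-≥⁻ (inj₂ refl) = ℤₚ.≤-refl

  ⌜_⌝ : ∀ {g i} → ℤ → GTerm g i
  ⌜ n ⌝ = int (numeral n)

  [i-1]+1≡i : ∀ a → (a ℤ.- 1ℤ) ℤ.+ 1ℤ ≡ a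
  [i-1]+1≡i a = trans (ℤₚ.+-assoc a (ℤ.- 1ℤ) 1ℤ) (ℤₚ.+-identityʳ a)

  module _ {g i} {Γ : List (Form σ₂ g i)} (t : ITerm i) where

    -- The recursive clause of D₀ matches only terms of the syntactic form `n ⊕ numeral 1ℤ`, so an
    -- arbitrary integer term has to be brought into this form.
    ≐-pred : Γ ⊢ int t ≐ int ((t ⊖ numeral 1ℤ) ⊕ numeral 1ℤ)
    ≐-pred = std (int t ≐ int ((t ⊖ numeral 1ℤ) ⊕ numeral 1ℤ)) λ μ ν →
      cong num (sym ([i-1]+1≡i (evalᴵ ν t)))

    ≥-pred : ∀ n → Γ ⊢ cmp ≥ (int t) ⌜ + suc n ⌝ → Γ ⊢ cmp ≥ (int (t ⊖ numeral 1ℤ)) ⌜ + n ⌝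
    ≥-pred n = ⇒E (std (cmp ≥ (int t) ⌜ + suc n ⌝ ⇒ cmp ≥ (int (t ⊖ numeral 1ℤ)) ⌜ + n ⌝) λ μ ν p →
      num-≥⁺ (ℤₚ.+-monoˡ-≤ (ℤ.- 1ℤ) (num-≥⁻ p)))

    ≥⇒>0 : ∀ n → Γ ⊢ cmp ≥ (int t) ⌜ + suc n ⌝ → Γ ⊢ cmp > (int t) ⌜ 0ℤ ⌝
    ≥⇒>0 n = ⇒E (std (cmp ≥ (int t) ⌜ + suc n ⌝ ⇒ cmp > (int t) ⌜ 0ℤ ⌝) λ μ ν p →
      num-mono (ℤₚ.<-≤-trans (ℤ.+<+ (ℕ.s≤s ℕ.z≤n)) (num-≥⁻ p)))

    -- The two cases are the two clauses of D₀ that mention F: the one for 1, and the recursive one,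
    -- whose guard is a condition on the predecessor.
    ≥1-cases : Γ ⊢ cmp ≥ (int t) ⌜ 1ℤ ⌝ →
               Γ ⊢ int t ≐ ⌜ 1ℤ ⌝ ∨ cmp > (int (t ⊖ numeral 1ℤ)) ⌜ 0ℤ ⌝
    ≥1-cases = ⇒E (std (cmp ≥ (int t) ⌜ 1ℤ ⌝ ⇒ int t ≐ ⌜ 1ℤ ⌝ ∨ cmp > (int (t ⊖ numeral 1ℤ)) ⌜ 0ℤ ⌝)
      λ { μ ν (inj₂ e) k → k (inj₁ e)
        ; μ ν (inj₁ p) k → k (inj₂ (num-mono (ℤₚ.+-monoˡ-< (ℤ.- 1ℤ) (num-≺⁻ p)))) })

    ≤-or-≥ : ∀ n → Γ ⊢ cmp ≤ (int t) ⌜ + n ⌝ ∨ cmp ≥ (int t) ⌜ + suc n ⌝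
    ≤-or-≥ n = std (cmp ≤ (int t) ⌜ + n ⌝ ∨ cmp ≥ (int t) ⌜ + suc n ⌝) λ μ ν k →
      case + n ℤₚ.<? evalᴵ ν t of λ where
        (yes p) → k (inj₂ (num-≥⁺ (ℤₚ.i<j⇒suc[i]≤j p)))
        (no p)  → k (inj₁ (num-≤⁺ (ℤₚ.≮⇒≥ p)))

  -- The axioms D₀ and D₁ at arbitrary terms

  subst-⟨⟩ : ∀ {P n g h i j} (σ : Fin g → GTerm h j) (τ : Fin i → ITerm j) (A : Form P n 0) ts →
             subst σ τ (A ⟨ ts ⟩) ≡ A ⟨ Vec.map (substᴳ σ τ) ts ⟩
  subst-⟨⟩ σ τ A ts = trans (subst-∘ _ _ _ _ A)
    (subst-cong (λ x → sym (Vecₚ.lookup-map x (substᴳ σ τ) ts)) (λ ()) A)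

  -- The lists of variables in D₀ and D₁ are all tabulations, so this one computation instantiates
  -- each of them.
  map-vars : ∀ {n g h i j} {σ : Fin g → GTerm h j} {τ : Fin i → ITerm j} {f : Fin n → Fin g} {ts} →
             (∀ x → σ (f x) ≡ Vec.lookup ts x) →
             Vec.map (substᴳ σ τ) (Vec.tabulate (λ x → gvar (f x))) ≡ ts
  map-vars {ts = ts} e =
    trans (sym (Vecₚ.tabulate-∘ _ _)) (trans (Vecₚ.tabulate-cong e) (Vecₚ.tabulate∘lookup ts))

  wkᵍ*-lookup : ∀ n {g i l} (ts : Vec (GTerm g i) l) x →
                wkᵍ* n (Vec.lookup ts x) ≡ Vec.lookup (Vec.map (wkᵍ* n) ts) x
  wkᵍ*-lookup n ts x = sym (Vecₚ.lookup-map x (wkᵍ* n) ts)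

  wkᵍ*-inst : ∀ n {g i} (ts : Fin n → GTerm g i) (t : GTerm g i) → substᴳ (instᵍ n ts) ivar (wkᵍ* n t) ≡ t
  wkᵍ*-inst n ts t = trans (substᴳ-∘ _ _ _ _ t)
    (trans (substᴳ-cong (instᵍ-↑ʳ n ts) (λ _ → refl) t) (substᴳ-id t))

  map-inverse : ∀ {A B : Set} {f : A → B} {h : B → A} → (∀ a → h (f a) ≡ a) →
                ∀ {n} (as : Vec A n) → Vec.map h (Vec.map f as) ≡ as
  map-inverse {f = f} {h} e as =
    trans (sym (Vecₚ.map-∘ h f as)) (trans (Vecₚ.map-cong e as) (Vecₚ.map-id as))

  ⇔E₁ : ∀ {g i} {Γ : List (Form σ₂ g i)} {A B} → Γ ⊢ A ⇔ B → Γ ⊢ A → Γ ⊢ B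
  ⇔E₁ d = ⇒E (∧E₁ d)

  ⇔E₂ : ∀ {g i} {Γ : List (Form σ₂ g i)} {A B} → Γ ⊢ A ⇔ B → Γ ⊢ B → Γ ⊢ A
  ⇔E₂ d = ⇒E (∧E₂ d)

  module Instances (m k : ℕ) (F : Form σ₀ (m + k) 0) where
    open D₀ m k F using (start; X; V; X′; V′; U′; N)
    open D₁ m k F using (atleast; atmost)

    holds : ∀ {g i} → Vec (GTerm g i) m → Vec (GTerm g i) k → Form σ₂ g i
    holds xs vs = ⌈ F ⌉ ⟨ xs ++ vs ⟩

    U : ∀ {g i} → Vec (GTerm (m + g) i) m
    U {g} = Vec.tabulate λ j → gvar (j ↑ˡ g)

    module _ {g h i j} (σ : Fin g → GTerm h j) (τ : Fin i → ITerm j) where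

      subst-holds : ∀ xs vs → subst σ τ (holds xs vs) ≡
                    holds (Vec.map (substᴳ σ τ) xs) (Vec.map (substᴳ σ τ) vs)
      subst-holds xs vs = trans (subst-⟨⟩ σ τ ⌈ F ⌉ (xs ++ vs)) (cong (⌈ F ⌉ ⟨_⟩) (Vecₚ.map-++ _ xs vs))

      subst-start : ∀ xs vs n → subst σ τ (start xs vs n) ≡
                    start (Vec.map (substᴳ σ τ) xs) (Vec.map (substᴳ σ τ) vs) (substᴵ τ n)
      subst-start xs vs n = cong (λ ts → atom (Start m k F) ts (substᴵ τ n ∷ [])) (Vecₚ.map-++ _ xs vs)

      subst-atleast : ∀ vs y → subst σ τ (atleast vs y) ≡ atleast (Vec.map (substᴳ σ τ) vs) (substᴳ σ τ y)
      subst-atleast vs y = cong (λ ts → atom (Atleast m k F) ts []) (Vecₚ.map-++ _ vs (y ∷ []))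

      subst-atmost : ∀ vs y → subst σ τ (atmost vs y) ≡ atmost (Vec.map (substᴳ σ τ) vs) (substᴳ σ τ y)
      subst-atmost vs y = cong (λ ts → atom (Atmost m k F) ts []) (Vecₚ.map-++ _ vs (y ∷ []))

    start-cong : ∀ {g i} {xs xs′ : Vec (GTerm g i) m} {vs vs′ : Vec (GTerm g i) k} {n n′} →
                 xs ≡ xs′ → vs ≡ vs′ → n ≡ n′ → start xs vs n ≡ start xs′ vs′ n′
    start-cong refl refl refl = refl

    module _ {g i} {Γ : List (Form σ₂ g i)} (xs : Vec (GTerm g i) m) (vs : Vec (GTerm g i) k) where
      private
        σ : Fin (m + k) → GTerm g i
        σ = Vec.lookup (xs ++ vs)

        X≡ : ∀ {j} {τ : Fin j → ITerm i} → Vec.map (substᴳ σ τ) X ≡ xs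
        X≡ = map-vars (Vecₚ.lookup-++ˡ xs vs)

        V≡ : ∀ {j} {τ : Fin j → ITerm i} → Vec.map (substᴳ σ τ) V ≡ vs
        V≡ = map-vars (Vecₚ.lookup-++ʳ xs vs)

      start-≐ : ∀ {s t} → Γ ⊢ int s ≐ int t → Γ ⊢ start xs vs s → Γ ⊢ start xs vs t
      start-≐ {s} {t} e d = cast (inst t) (≐Eⁱ A e (cast (sym (inst s)) d))
        where
        A : Form σ₂ g (suc i)
        -- `≐Eⁱ` needs a formula with a fresh integer variable in the place to be rewritten;
        -- weakening the tuples makes room for it.
        A = start (Vec.map wkⁱ xs) (Vec.map wkⁱ vs) (ivar zero)

        back : ∀ u t → substᴳ gvar (extend u ivar) (wkⁱ t) ≡ t
        back u t = trans (substᴳ-∘ _ _ _ _ t) (substᴳ-id t)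

        inst : ∀ u → A [ u ]ⁱ ≡ start xs vs u
        inst u = trans (subst-start gvar (extend u ivar) (Vec.map wkⁱ xs) (Vec.map wkⁱ vs) (ivar zero))
          (start-cong (map-inverse (back u) xs) (map-inverse (back u) vs) refl)

      start-0 : Γ ⊢ start xs vs (numeral 0ℤ)
      start-0 = ⇒E
        (cast (cong (cmp ≤ ⌜ 0ℤ ⌝ ⌜ 0ℤ ⌝ ⇒_)
                (trans (subst-start σ (λ _ → numeral 0ℤ) X V N)
                  (start-cong X≡ V≡ refl)))
              (closeE {A = D₀.start-≤0 m k F} (axiom (ax-start-≤0 m k F)) σ (λ _ → numeral 0ℤ)))
        (std (cmp ≤ ⌜ 0ℤ ⌝ ⌜ 0ℤ ⌝) (λ _ _ → inj₂ refl))

      start-1 : Γ ⊢ start xs vs (numeral 1ℤ) ⇔ holds xs vs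
      start-1 = cast
        (cong₂ _⇔_
          (trans (subst-start σ (λ ()) X V (numeral 1ℤ))
            (start-cong X≡ V≡ refl))
          (subst-cong (λ _ → refl) (λ ()) ⌈ F ⌉))
        (closeE {A = D₀.start-1 m k F} (axiom (ax-start-1 m k F)) σ (λ ()))

      start-suc : ∀ {n} → Γ ⊢ cmp > (int n) ⌜ 0ℤ ⌝ →
                  Γ ⊢ start xs vs (n ⊕ numeral 1ℤ) ⇔ holds xs vs ∧
                      ∃ᵍ* m (Vec.map (wkᵍ* m) xs <lex U ∧ start U (Vec.map (wkᵍ* m) vs) n)
      start-suc {n} = ⇒E (cast
        (cong (cmp > (int n) ⌜ 0ℤ ⌝ ⇒_) (cong₂ _⇔_
          (trans (subst-start σ τ X V (N ⊕ numeral 1ℤ)) (start-cong X≡ V≡ refl))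
          (cong₂ _∧_
            (trans (subst-holds σ τ X V) (cong₂ holds X≡ V≡))
            (trans (subst-∃ᵍ* m σ τ (X′ <lex U′ ∧ start U′ V′ N)) (cong (∃ᵍ* m) (cong₂ _∧_
              (trans (subst-<lex σ′ τ X′ U′) (cong₂ _<lex_ X′≡ U≡))
              (trans (subst-start σ′ τ U′ V′ N) (start-cong U≡ V′≡ refl))))))))
        (closeE {A = D₀.start-+1 m k F} (axiom (ax-start-+1 m k F)) σ τ))
        where
        τ : Fin 1 → ITerm i
        τ _ = n

        σ′ : Fin (m + (m + k)) → GTerm (m + g) i
        σ′ = liftᵍ* m σ

        X′≡ : Vec.map (substᴳ σ′ τ) X′ ≡ Vec.map (wkᵍ* m) xs
        X′≡ = map-vars λ x → trans (liftᵍ*-↑ʳ m σ (x ↑ˡ k))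
          (trans (cong (wkᵍ* m) (Vecₚ.lookup-++ˡ xs vs x)) (wkᵍ*-lookup m xs x))

        V′≡ : Vec.map (substᴳ σ′ τ) V′ ≡ Vec.map (wkᵍ* m) vs
        V′≡ = map-vars λ x → trans (liftᵍ*-↑ʳ m σ (m ↑ʳ x))
          (trans (cong (wkᵍ* m) (Vecₚ.lookup-++ʳ xs vs x)) (wkᵍ*-lookup m vs x))

        U≡ : Vec.map (substᴳ σ′ τ) U′ ≡ U
        U≡ = map-vars λ x → trans (liftᵍ*-↑ˡ m σ x) (sym (Vecₚ.lookup∘tabulate _ x))

      start-sucI : ∀ us {n} → Γ ⊢ cmp > (int n) ⌜ 0ℤ ⌝ → Γ ⊢ holds xs vs → Γ ⊢ xs <lex us →
                   Γ ⊢ start us vs n → Γ ⊢ start xs vs (n ⊕ numeral 1ℤ)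
      start-sucI us {n} n>0 h l s = ⇔E₂ (start-suc n>0) (∧I h (∃ᵍ*I m ts (cast
        (sym (cong₂ _∧_
          (trans (subst-<lex (instᵍ m ts) ivar (Vec.map (wkᵍ* m) xs) U) (cong₂ _<lex_ (map-inverse (wkᵍ*-inst m ts) xs) U≡))
          (trans (subst-start (instᵍ m ts) ivar U (Vec.map (wkᵍ* m) vs) n)
            (start-cong U≡ (map-inverse (wkᵍ*-inst m ts) vs) (substᴵ-id n)))))
        (∧I l s))))
        where
        ts : Fin m → GTerm g i
        ts = Vec.lookup us

        U≡ : Vec.map (substᴳ (instᵍ m ts) ivar) U ≡ us
        U≡ = map-vars (instᵍ-↑ˡ m ts)

    -- Weakening by the variables X and N bound in D₁.
    ⇑ : ∀ {g i} → GTerm g i → GTerm (m + g) (suc i)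
    ⇑ t = wkⁱ (wkᵍ* m t)

    weaken-⇑ : ∀ {g i n} (A : Form σ₂ n 0) (ts : Vec (GTerm g i) n) →
               weakenⁱ (weakenᵍ* m (A ⟨ ts ⟩)) ≡ A ⟨ Vec.map ⇑ ts ⟩
    weaken-⇑ A ts = trans (cong weakenⁱ (subst-⟨⟩ _ _ A ts))
      (trans (subst-⟨⟩ _ _ A (Vec.map (wkᵍ* m) ts)) (cong (A ⟨_⟩) (sym (Vecₚ.map-∘ wkⁱ (wkᵍ* m) ts))))

    atleastBody atmostBody : ∀ {g i} → Vec (GTerm g i) k → GTerm g i → Form σ₂ (m + g) (suc i)
    atleastBody vs y = start U (Vec.map ⇑ vs) (ivar zero) ∧ cmp ≥ (int (ivar zero)) (⇑ y)
    atmostBody  vs y = start U (Vec.map ⇑ vs) (ivar zero) ⇒ cmp ≤ (int (ivar zero)) (⇑ y)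

    module _ {g i} {Γ : List (Form σ₂ g i)} {vs : Vec (GTerm g i) k} {y : GTerm g i} where

      private
        σ : Fin (suc k) → GTerm g i
        σ = extend y (Vec.lookup vs)

        σ′ : Fin (m + suc k) → GTerm (m + g) (suc i)
        σ′ = wkⁱ ∘ liftᵍ* m σ

        τ′ : Fin 1 → ITerm (suc i)
        τ′ = liftⁱ (λ ())

        V≡ : Vec.map (substᴳ σ (λ ())) (D₁.V m k F) ≡ vs
        V≡ = map-vars (λ _ → refl)

        start≡ : subst σ′ τ′ (start (D₁.X′ m k F) (D₁.V′ m k F) (D₁.N m k F)) ≡
                 start U (Vec.map ⇑ vs) (ivar zero)
        start≡ = trans (subst-start σ′ τ′ (D₁.X′ m k F) (D₁.V′ m k F) (D₁.N m k F)) (start-cong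
          (map-vars {ts = U} λ x → trans (cong wkⁱ (liftᵍ*-↑ˡ m σ x)) (sym (Vecₚ.lookup∘tabulate _ x)))
          (map-vars {ts = Vec.map ⇑ vs} λ x → trans (cong wkⁱ (liftᵍ*-↑ʳ m σ (suc x))) (sym (Vecₚ.lookup-map x ⇑ vs)))
          refl)

        Y≡ : σ′ (m ↑ʳ zero) ≡ ⇑ y
        Y≡ = cong wkⁱ (liftᵍ*-↑ʳ m σ zero)

      atleast-def : Γ ⊢ atleast vs y ⇔ ∃ᵍ* m (∃ⁱ (atleastBody vs y))
      atleast-def = cast
        (cong₂ _⇔_
          (trans (subst-atleast σ (λ ()) (D₁.V m k F) (D₁.Y m k F)) (cong (λ us → atleast us y) V≡))
          (trans (subst-∃ᵍ* m σ (λ ()) _)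
            (cong (∃ᵍ* m ∘ ∃ⁱ) (cong₂ _∧_ start≡ (cong (cmp ≥ (int (ivar zero))) Y≡)))))
        (closeE {A = D₁.def-atleast m k F} (axiom (ax-atleast m k F)) σ (λ ()))

      atmost-def : Γ ⊢ atmost vs y ⇔ ∀ᵍ* m (∀ⁱ (atmostBody vs y))
      atmost-def = cast
        (cong₂ _⇔_
          (trans (subst-atmost σ (λ ()) (D₁.V m k F) (D₁.Y m k F)) (cong (λ us → atmost us y) V≡))
          (trans (subst-∀ᵍ* m σ (λ ()) _)
            (cong (∀ᵍ* m ∘ ∀ⁱ) (cong₂ _⇒_ start≡ (cong (cmp ≤ (int (ivar zero))) Y≡)))))
        (closeE {A = D₁.def-atmost m k F} (axiom (ax-atmost m k F)) σ (λ ()))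

      module _ (xs : Vec (GTerm g i) m) (n : ITerm i) where
        private
          ρ : Fin (m + g) → GTerm g i
          ρ = instᵍ m (Vec.lookup xs)

          ⇑-inst : ∀ t → substᴳ ρ (extend n ivar) (⇑ t) ≡ t
          ⇑-inst t = trans (substᴳ-∘ _ _ _ _ (wkᵍ* m t)) (wkᵍ*-inst m (Vec.lookup xs) t)

          body-inst : ∀ A → subst (wkⁱ ∘ ρ) (liftⁱ ivar) A [ n ]ⁱ ≡ subst {σ₂} ρ (extend n ivar) A
          body-inst A = trans (subst-∘ _ _ _ _ A) (subst-cong
            (λ x → trans (substᴳ-∘ _ _ _ _ (ρ x)) (substᴳ-id _))
            (λ { zero → refl ; (suc x) → refl }) A)

          start-inst : subst ρ (extend n ivar) (start U (Vec.map ⇑ vs) (ivar zero)) ≡ start xs vs n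
          start-inst = trans (subst-start ρ (extend n ivar) U (Vec.map ⇑ vs) (ivar zero))
            (start-cong (map-vars (instᵍ-↑ˡ m (Vec.lookup xs))) (map-inverse ⇑-inst vs) refl)

        atleastI : Γ ⊢ start xs vs n → Γ ⊢ cmp ≥ (int n) y → Γ ⊢ atleast vs y
        atleastI s l = ⇔E₂ atleast-def (∃ᵍ*I m (Vec.lookup xs) (∃ⁱI n (cast
          (sym (trans (body-inst (atleastBody vs y)) (cong₂ _∧_ start-inst (cong (cmp ≥ (int n)) (⇑-inst y)))))
          (∧I s l))))

        atmostE : Γ ⊢ atmost vs y → Γ ⊢ start xs vs n → Γ ⊢ cmp ≤ (int n) y
        atmostE d = ⇒E (cast
          (trans (body-inst (atmostBody vs y)) (cong₂ _⇒_ start-inst (cong (cmp ≤ (int n)) (⇑-inst y))))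
          (∀ⁱE n (∀ᵍ*E m (Vec.lookup xs) (⇔E₁ atmost-def d))))

  -- Sorting inside a derivation

  module _ {m : ℕ} where

    infix 4 _⊢_↗_ _⊢_≠*_

    _⊢_↗_ _⊢_≠*_ : ∀ {g i} → List (Form σ₂ g i) → (xs ys : Vec (GTerm g i) m) → Set
    Γ ⊢ xs ↗ ys  = Γ ⊢ xs <lex ys
    Γ ⊢ xs ≠* ys = Γ ⊢ ~ (xs ≐* ys)

    -- The case distinctions of a sorting algorithm become ∨E, so the sorted list depends on the branch.
    insert : ∀ {g i} {Γ : List (Form σ₂ g i)} {C} x ys →
             AllPairs (Γ ⊢_↗_) ys → All (Γ ⊢ x ≠*_) ys →
             (∀ {Δ} → Γ ⊆ Δ → ∀ zs → x ∷ ys ↭ zs → AllPairs (Δ ⊢_↗_) zs → Δ ⊢ C) → Γ ⊢ C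
    insert x []       []       []       κ = κ id (x ∷ []) ↭-refl ([] ∷ [])
    insert x (y ∷ ys) (p ∷ ps) (n ∷ ns) κ = ∨E (<lex-connex x y)
      (κ there (x ∷ y ∷ ys) ↭-refl
        ((hyp (here refl) ∷ All.map (λ {z} d → <lex-trans x y z (hyp (here refl)) (weaken there d)) p)
         ∷ All.map (weaken there) p ∷ AllPairs.map (weaken there) ps))
      (∨E (hyp (here refl))
        (⊥E (⇒E (weaken (there ∘ there) n) (hyp (here refl))))
        (insert x ys (AllPairs.map (weaken (there ∘ there)) ps) (All.map (weaken (there ∘ there)) ns)
          λ ι zs π s → κ (ι ∘ there ∘ there) (y ∷ zs) (↭-trans (↭-swap x y ↭-refl) (↭-prep y π))
            -- `y` precedes all of `zs`, a permutation of `x ∷ ys`: it is below `x` in this branch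
            -- and below `ys` by sortedness.
            (All-resp-↭ π (weaken ι (hyp (here refl)) ∷ All.map (weaken (ι ∘ there ∘ there)) p) ∷ s)))

    -- Insertion sort; the permutation obtained for the tail carries the inequalities between `y`
    -- and the tail over to the sorted tail.
    sort : ∀ {g i} {Γ : List (Form σ₂ g i)} {C} ys → AllPairs (Γ ⊢_≠*_) ys →
           (∀ {Δ} → Γ ⊆ Δ → ∀ zs → ys ↭ zs → AllPairs (Δ ⊢_↗_) zs → Δ ⊢ C) → Γ ⊢ C
    sort []       []       κ = κ id [] ↭-refl []
    sort (y ∷ ys) (n ∷ ns) κ = sort ys ns λ ι zs π s →
      insert y zs s (All-resp-↭ π (All.map (weaken ι) n)) λ ι′ zs′ π′ s′ →
        κ (ι′ ∘ ι) zs′ (↭-trans (↭-prep y π) π′) s′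

  -- Finite conjunctions and disjunctions inside a derivation

  ⋀I : ∀ {g i} {Γ : List (Form σ₂ g i)} {X : Set} (f : X → Form σ₂ g i) l →
       (∀ {x} → x ∈ l → Γ ⊢ f x) → Γ ⊢ ⋀ (List.map f l)
  ⋀I f []      d = ⇒I (hyp (here refl))
  ⋀I f (x ∷ l) d = ∧I (d (here refl)) (⋀I f l (d ∘ there))

  ⋀E : ∀ {g i} {Γ : List (Form σ₂ g i)} {X : Set} (f : X → Form σ₂ g i) {l} →
       Γ ⊢ ⋀ (List.map f l) → ∀ {x} → x ∈ l → Γ ⊢ f x
  ⋀E f d (here refl) = ∧E₁ d
  ⋀E f d (there p)   = ⋀E f (∧E₂ d) p

  subst-⋀I : ∀ {g h i j} (σ : Fin g → GTerm h j) (τ : Fin i → ITerm j) {Γ : List (Form σ₂ h j)}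
             {X : Set} (f : X → Form σ₂ g i) l →
             (∀ {x} → x ∈ l → Γ ⊢ subst σ τ (f x)) → Γ ⊢ subst σ τ (⋀ (List.map f l))
  subst-⋀I σ τ f l d =
    cast (sym (⋀-map (subst σ τ) refl (λ _ _ → refl) f l)) (⋀I (subst σ τ ∘ f) l d)

  -- Intuitionistic because each `f x` is decided separately. For equality of two copies, the
  -- alternatives are `someEqual` and `distinct`.
  ⋁-dec : ∀ {g i} {Γ : List (Form σ₂ g i)} {X : Set} (f : X → Form σ₂ g i) l →
          (∀ x → Γ ⊢ f x ∨ ~ f x) →
          Γ ⊢ ⋁ (List.map f l) ∨ ⋀ (List.map (λ x → ~ f x) l)
  ⋁-dec f []      d = ∨I₂ (⇒I (hyp (here refl)))
  ⋁-dec f (x ∷ l) d = ∨E (d x)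
    (∨I₁ (∨I₁ (hyp (here refl))))
    (∨E (weaken there (⋁-dec f l d))
      (∨I₁ (∨I₂ (hyp (here refl))))
      (∨I₂ (∧I (hyp (there (here refl))) (hyp (here refl)))))

  ⋁⋀-contra : ∀ {g i} {Γ : List (Form σ₂ g i)} {X : Set} (f : X → Form σ₂ g i) l →
              Γ ⊢ ⋁ (List.map f l) → Γ ⊢ ⋀ (List.map (λ x → ~ f x) l) → Γ ⊢ ⊥ᶠ
  ⋁⋀-contra f []      d e = d
  ⋁⋀-contra f (x ∷ l) d e = ∨E d
    (⇒E (weaken there (∧E₁ e)) (hyp (here refl)))
    (⋁⋀-contra f l (hyp (here refl)) (weaken there (∧E₂ e)))

  -- The weakened formula is instantiated at the `n` variables over which it was weakened; the
  -- lifted renaming followed by this instantiation fixes every variable.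
  ∀ᵍ*-reinstantiate : ∀ n {g i} {Γ : List (Form σ₂ (n + g) i)} {A : Form σ₂ (n + g) i} →
                      Γ ⊢ weakenᵍ* n (∀ᵍ* n A) → Γ ⊢ A
  ∀ᵍ*-reinstantiate n {g} {i} {A = A} d = cast
    (trans (subst-∘ _ _ _ _ A) (trans (subst-cong back (λ _ → refl) A) (subst-id A)))
    (∀ᵍ*E n ts (cast (subst-∀ᵍ* n _ _ A) d))
    where
    ts : Fin n → GTerm (n + g) i
    ts x = gvar (x ↑ˡ g)

    back : ∀ x → substᴳ (instᵍ n ts) ivar (liftᵍ* n (λ y → gvar (n ↑ʳ y)) x) ≡ gvar x
    back x with Fin.splitAt n x | Finₚ.join-splitAt n g x
    ... | inj₁ y | refl = trans (cong (substᴳ (instᵍ n ts) ivar) (liftᵍ*-↑ˡ n _ y)) (instᵍ-↑ˡ n ts y)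
    ... | inj₂ y | refl = trans (cong (substᴳ (instᵍ n ts) ivar) (liftᵍ*-↑ʳ n _ y)) (instᵍ-↑ʳ n ts (n ↑ʳ y))

  -- `precomputed r` does not reduce until `r` is split into numeral and other term; these equations
  -- let later proofs treat `r` uniformly.
  evalᴳ-precomputed : ∀ {g i} {μ : Fin g → Term} {ν : Fin i → ℤ} r → evalᴳ μ ν (precomputed r) ≡ r
  evalᴳ-precomputed (num n)   = refl
  evalᴳ-precomputed (other c) = refl

  substᴳ-precomputed : ∀ {g h i j} (σ : Fin g → GTerm h j) (τ : Fin i → ITerm j) r →
                       substᴳ σ τ (precomputed r) ≡ precomputed r
  substᴳ-precomputed σ τ (num n)   = refl
  substᴳ-precomputed σ τ (other c) = refl

  -- Counting

  module _ (m k : ℕ) (F : Form σ₀ (m + k) 0) where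
    open D₀ m k F using (start)
    open Counting m k F
    open Instances m k F

    -- Built from the greatest tuple backwards: the clause for 1 starts the chain, and each smaller
    -- tuple is put in front by the recursive clause.
    start-sorted : ∀ {g i} {Γ : List (Form σ₂ g i)} vs x xs →
                   AllPairs (Γ ⊢_↗_) (x ∷ xs) → All (λ y → Γ ⊢ holds y vs) (x ∷ xs) →
                   Γ ⊢ start x vs (numeral (+ suc (List.length xs)))
    start-sorted vs x []       _              (h ∷ []) = ⇔E₂ (start-1 x vs) h
    start-sorted vs x (y ∷ ys) ((l ∷ _) ∷ ls) (h ∷ hs) = start-≐ x vs
      -- `start-sucI` produces a compound sum; Std equates it with the numeral wanted.
      (std (int (numeral (+ suc n) ⊕ numeral 1ℤ) ≐ ⌜ + suc (suc n) ⌝)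
           (λ _ _ → cong (num ∘ +_ ∘ suc) (ℕₚ.+-comm n 1)))
      (start-sucI x vs y (std (cmp > ⌜ + suc n ⌝ ⌜ 0ℤ ⌝) (λ _ _ → num-mono (ℤ.+<+ (ℕ.s≤s ℕ.z≤n))))
                  h l (start-sorted vs y ys ls hs))
      where n = List.length ys

    -- Which tuple is the least depends on the branch of the sorting, so `x` is handed to the
    -- continuation instead of being named in advance.
    start-distinct : ∀ n {g i} {Γ : List (Form σ₂ g i)} {vs C} (X : Fin (suc n) → Vec (GTerm g i) m) →
                     (∀ a → Γ ⊢ holds (X a) vs) → (∀ {a b} → a Fin.< b → Γ ⊢ X a ≠* X b) →
                     (∀ {Δ} → Γ ⊆ Δ → ∀ x → Δ ⊢ start x vs (numeral (+ suc n)) → Δ ⊢ C) → Γ ⊢ C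
    start-distinct n {vs = vs} {C} X h d κ = sort (List.tabulate X) (AllPairsₚ.tabulate⁺-< {f = X} d) λ ι zs π s →
      go ι zs (trans (sym (↭-length π)) (Listₚ.length-tabulate X)) s
        (All-resp-↭ π (All.map (weaken ι) (Allₚ.tabulate⁺ {f = X} h)))
      where
      -- The length equation excludes the empty list and turns the numeral of `start-sorted` into
      -- the required one.
      go : ∀ {Δ} → _ ⊆ Δ → ∀ zs → List.length zs ≡ suc n → AllPairs (Δ ⊢_↗_) zs →
           All (λ y → Δ ⊢ holds y vs) zs → Δ ⊢ C
      go ι (z ∷ zs) refl s hs = κ ι z (start-sorted vs z zs s hs)

    start≥1⇒holds : ∀ {g i} {Γ : List (Form σ₂ g i)} xs vs {t} →
                    Γ ⊢ start xs vs t → Γ ⊢ cmp ≥ (int t) ⌜ 1ℤ ⌝ → Γ ⊢ holds xs vs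
    start≥1⇒holds xs vs {t} s t≥1 = ∨E (≥1-cases t t≥1)
      (⇔E₁ (start-1 xs vs) (start-≐ xs vs (hyp (here refl)) (weaken there s)))
      (∧E₁ (⇔E₁ (start-suc xs vs (hyp (here refl))) (start-≐ xs vs (≐-pred t) (weaken there s))))

    -- In the step, t ≥ n + 2 gives t = (t - 1) + 1 with t - 1 > 0, so that start-suc applies.
    chain : ∀ n {g i} {Γ : List (Form σ₂ g i)} xs vs {t C} →
            Γ ⊢ start xs vs t → Γ ⊢ cmp ≥ (int t) ⌜ + suc n ⌝ →
            (∀ {h j} {Δ : List (Form σ₂ h j)} (σ : Fin g → GTerm h j) (τ : Fin i → ITerm j) →
               Γ ⊑[ σ , τ ] Δ → (X : Fin (suc n) → Vec (GTerm h j) m) →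
               -- The head must be known, because D₀ compares a tuple put in front only with the
               -- head.
               X zero ≡ Vec.map (substᴳ σ τ) xs →
               (∀ a → Δ ⊢ holds (X a) (Vec.map (substᴳ σ τ) vs)) →
               (∀ {a b} → a Fin.< b → Δ ⊢ X a ↗ X b) → Δ ⊢ subst σ τ C) →
            Γ ⊢ C
    chain zero {Γ = Γ} xs vs {C = C} s t≥1 κ = cast (subst-id C)
      (κ gvar ivar (λ {A} p → ≡.subst (_∈ Γ) (sym (subst-id A)) p) (λ _ → xs)
         (sym (id≡ xs)) (λ _ → ≡.subst (λ us → Γ ⊢ holds xs us) (sym (id≡ vs)) (start≥1⇒holds xs vs s t≥1))
         λ { {zero} {zero} () })
      where
      id≡ : ∀ {n} (us : Vec _ n) → Vec.map (substᴳ gvar ivar) us ≡ us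
      id≡ us = trans (Vecₚ.map-cong substᴳ-id us) (Vecₚ.map-id us)
    chain (suc n) {g} {i} {Γ} xs vs {t} {C} s t≥ κ =
      ∃ᵍ*E m (∧E₂ unfolded) (chain n U (Vec.map (wkᵍ* m) vs) (∧E₂ (hyp (here refl)))
        (cast (cong (λ u → cmp ≥ (int u) ⌜ + suc n ⌝) (substᴵ-id t′)) (substitute ι₀ t′≥))
        prepend)
      where
      t′ : ITerm i
      t′ = t ⊖ numeral 1ℤ

      t′≥ : Γ ⊢ cmp ≥ (int t′) ⌜ + suc n ⌝
      t′≥ = ≥-pred t (suc n) t≥

      B : Form σ₂ (m + g) i
      B = Vec.map (wkᵍ* m) xs <lex U ∧ start U (Vec.map (wkᵍ* m) vs) t′

      unfolded : Γ ⊢ holds xs vs ∧ ∃ᵍ* m B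
      unfolded = ⇔E₁ (start-suc xs vs (≥⇒>0 t′ n t′≥)) (start-≐ xs vs (≐-pred t) s)

      ι₀ : Γ ⊑[ (λ x → gvar (m ↑ʳ x)) , ivar ] (B ∷ List.map (weakenᵍ* m) Γ)
      ι₀ p = there (∈-map⁺ (weakenᵍ* m) p)

      prepend : ∀ {h j} {Δ : List (Form σ₂ h j)} (σ : Fin (m + g) → GTerm h j) (τ : Fin i → ITerm j) →
                (B ∷ List.map (weakenᵍ* m) Γ) ⊑[ σ , τ ] Δ → (X : Fin (suc n) → Vec (GTerm h j) m) →
                X zero ≡ Vec.map (substᴳ σ τ) U →
                (∀ a → Δ ⊢ holds (X a) (Vec.map (substᴳ σ τ) (Vec.map (wkᵍ* m) vs))) →
                (∀ {a b} → a Fin.< b → Δ ⊢ X a ↗ X b) → Δ ⊢ subst σ τ (weakenᵍ* m C)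
      prepend {h} {j} {Δ} σ τ ι X X₀ hs ls =
        cast (sym (subst-∘ σ τ _ _ C)) (κ σ′ τ ι′ (extend x X) refl hs′ ls′)
        where
        σ′ : Fin g → GTerm h j
        σ′ y = σ (m ↑ʳ y)

        ι′ : Γ ⊑[ σ′ , τ ] Δ
        ι′ {A} p = ≡.subst (_∈ Δ) (subst-∘ σ τ _ _ A) (ι (ι₀ p))

        x : Vec (GTerm h j) m
        x = Vec.map (substᴳ σ′ τ) xs

        wk≡ : ∀ {l} (us : Vec (GTerm g i) l) →
              Vec.map (substᴳ σ τ) (Vec.map (wkᵍ* m) us) ≡ Vec.map (substᴳ σ′ τ) us
        wk≡ us = trans (sym (Vecₚ.map-∘ _ _ us)) (Vecₚ.map-cong (substᴳ-∘ σ τ _ _) us)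

        x↗X₀ : Δ ⊢ x ↗ X zero
        x↗X₀ = cast (trans (subst-<lex σ τ (Vec.map (wkᵍ* m) xs) U) (cong₂ _<lex_ (wk≡ xs) (sym X₀)))
          (substitute ι (∧E₁ (hyp (here refl))))

        hs′ : ∀ a → Δ ⊢ holds (extend x X a) (Vec.map (substᴳ σ′ τ) vs)
        hs′ zero    = cast (subst-holds σ′ τ xs vs) (substitute ι′ (∧E₁ unfolded))
        hs′ (suc a) = cast (cong (holds (X a)) (wk≡ vs)) (hs a)

        ls′ : ∀ {a b} → a Fin.< b → Δ ⊢ extend x X a ↗ extend x X b
        ls′ {zero}  {suc zero}    _         = x↗X₀
        -- D₀ gives only the link to the next tuple; the others follow by transitivity.
        ls′ {zero}  {suc (suc b)} _         = <lex-trans x (X zero) (X (suc b)) x↗X₀ (ls (ℕ.s≤s ℕ.z≤n))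
        ls′ {suc a} {suc b}       (ℕ.s≤s p) = ls p

    -- Indexed so that `many n` is `∃≥` at the numeral n + 1 while `noMore n` is `∃≤` at n: both
    -- speak of the same `suc n` copies.
    many : ∀ n → Form σ₂ k 0
    many n = ∃ᵍ* (suc n * m) (F-all (suc n) ∧ distinct (suc n))

    noMore : ∀ n → Form σ₂ k 0
    noMore n = ∀ᵍ* (suc n * m) (F-all (suc n) ⇒ someEqual (suc n))

    manyI : ∀ n {g i} {Γ : List (Form σ₂ g i)} {vs} (X : Fin (suc n) → Vec (GTerm g i) m) →
            (∀ a → Γ ⊢ holds (X a) vs) → (∀ {a b} → a Fin.< b → Γ ⊢ X a ≠* X b) → Γ ⊢ many n ⟨ vs ⟩
    manyI n {g} {i} {vs = vs} X h d =
      cast (sym (subst-∃ᵍ* p (Vec.lookup vs) (λ ()) body)) (∃ᵍ*I p ts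
        (cast (sym (trans (subst-∘ _ _ _ _ body) (subst-cong (λ _ → refl) (λ ()) body))) (∧I
          (subst-⋀I ρ θ (λ a → holds (copy (suc n) a) (V (suc n))) (List.allFin (suc n)) λ {a} _ →
            cast (sym (trans (subst-holds ρ θ (copy (suc n) a) (V (suc n))) (cong₂ holds (copy≡ a) V≡))) (h a))
          (subst-⋀I ρ θ (λ (a , b) → ~ (copy (suc n) a ≐* copy (suc n) b)) (pairs (suc n)) λ {(a , b)} q →
            cast (cong ~_ (sym (trans (subst-≐* ρ θ (copy (suc n) a) (copy (suc n) b))
                                      (cong₂ _≐*_ (copy≡ a) (copy≡ b)))))
                 (d (proj₂ (∈-filter⁻ (uncurry Finₚ._<?_)
                      {xs = List.cartesianProduct (List.allFin (suc n)) (List.allFin (suc n))} q)))))))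
      where
      p : ℕ
      p = suc n * m

      body : Form σ₂ (p + k) 0
      body = F-all (suc n) ∧ distinct (suc n)

      entry : Fin (suc n) × Fin m → GTerm g i
      entry (a , j) = Vec.lookup (X a) j

      ts : Fin p → GTerm g i
      -- `copy` numbers its variables by `combine`, which `remQuot` inverts.
      ts c = entry (Fin.remQuot m c)

      ρ : Fin (p + k) → GTerm g i
      ρ x = substᴳ (instᵍ p ts) ivar (liftᵍ* p (Vec.lookup vs) x)

      θ : Fin 0 → ITerm i
      θ ()

      copy≡ : ∀ a → Vec.map (substᴳ ρ θ) (copy (suc n) a) ≡ X a
      copy≡ a = map-vars λ j →
        trans (cong (substᴳ (instᵍ p ts) ivar) (liftᵍ*-↑ˡ p (Vec.lookup vs) (Fin.combine a j)))
          (trans (instᵍ-↑ˡ p ts (Fin.combine a j)) (cong entry (Finₚ.remQuot-combine a j)))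

      V≡ : Vec.map (substᴳ ρ θ) (V (suc n)) ≡ vs
      V≡ = map-vars λ j →
        trans (cong (substᴳ (instᵍ p ts) ivar) (liftᵍ*-↑ʳ p (Vec.lookup vs) j))
          (wkᵍ*-inst p ts (Vec.lookup vs j))

    start⇒many : ∀ n {g i} {Γ : List (Form σ₂ g i)} xs vs {t} →
                 Γ ⊢ start xs vs t → Γ ⊢ cmp ≥ (int t) ⌜ + suc n ⌝ → Γ ⊢ many n ⟨ vs ⟩
    start⇒many n xs vs s t≥ = chain n xs vs s t≥ λ σ τ ι X _ hs ls →
      cast (sym (subst-⟨⟩ σ τ (many n) vs)) (manyI n X hs (λ {a} {b} a<b → <lex⇒≠ (X a) (X b) (ls a<b)))

    -- Lets results stated at arbitrary terms be used for formulas whose scope is V itself.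
    ⟨V₀⟩-id : ∀ (A : Form σ₂ k 0) → A ⟨ V₀ ⟩ ≡ A
    ⟨V₀⟩-id A = trans (subst-cong (Vecₚ.lookup∘tabulate gvar) (λ ()) A) (subst-id A)

    copies⇒start : ∀ n {Γ : List (Form σ₂ (suc n * m + k) 0)} {C} →
                   Γ ⊢ F-all (suc n) → Γ ⊢ distinct (suc n) →
                   (∀ {Δ} → Γ ⊆ Δ → ∀ x → Δ ⊢ start x (V (suc n)) (numeral (+ suc n)) → Δ ⊢ C) → Γ ⊢ C
    copies⇒start n h d = start-distinct n (copy (suc n))
      (λ a → ⋀E (λ a → holds (copy (suc n) a) (V (suc n))) h (∈-allFin a))
      (λ {a} {b} a<b → ⋀E (λ (a , b) → ~ (copy (suc n) a ≐* copy (suc n) b)) d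
        (∈-filter⁺ (uncurry Finₚ._<?_) (∈-cartesianProduct⁺ (∈-allFin a) (∈-allFin b)) a<b))

    module _ (n : ℕ) where
      private
        p : ℕ
        p = suc n * m

        V₀≡ : Vec.map (wkᵍ* p) V₀ ≡ V (suc n)
        V₀≡ = sym (Vecₚ.tabulate-∘ (wkᵍ* p) gvar)

      atleast⇔many : [] ⊢ atleast V₀ ⌜ + suc n ⌝ ⇔ many n
      atleast⇔many = ∧I
        (⇒I (∃ᵍ*E m (⇔E₁ atleast-def (hyp (here refl))) (∃ⁱE (hyp (here refl))
          (cast (trans (sym (weaken-⇑ (many n) V₀)) (cong (weakenⁱ ∘ weakenᵍ* m) (⟨V₀⟩-id (many n))))
            (start⇒many n U (Vec.map ⇑ V₀) (∧E₁ (hyp (here refl))) (∧E₂ (hyp (here refl))))))))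
        (⇒I (∃ᵍ*E p (hyp (here refl))
          (cast (sym (trans (subst-atleast _ _ V₀ ⌜ + suc n ⌝) (cong (λ vs → atleast vs ⌜ + suc n ⌝) V₀≡)))
            (copies⇒start n (∧E₁ (hyp (here refl))) (∧E₂ (hyp (here refl))) λ ι x s →
              -- The witness for N is the number of tuples, at which the bound N ≥ Y is an equality.
              atleastI x (numeral (+ suc n)) s
                (std (cmp ≥ ⌜ + suc n ⌝ ⌜ + suc n ⌝) (λ _ _ → inj₂ refl))))))

      -- Derived over V alone, so that `substitute` can carry it into the scope of X and N where it
      -- is applied.
      many⇒¬noMore : noMore n ∷ many n ∷ [] ⊢ ⊥ᶠ
      many⇒¬noMore = ∃ᵍ*E p (hyp (there (here refl)))
        (⋁⋀-contra (λ (a , b) → copy (suc n) a ≐* copy (suc n) b) (pairs (suc n))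
          (⇒E (∀ᵍ*-reinstantiate p (hyp (there (here refl)))) (∧E₁ (hyp (here refl))))
          (∧E₂ (hyp (here refl))))

      atmost⇔noMore : [] ⊢ atmost V₀ ⌜ + n ⌝ ⇔ noMore n
      atmost⇔noMore = ∧I
        (⇒I (∀ᵍ*I p (⇒I (∨E
          (⋁-dec (λ (a , b) → copy (suc n) a ≐* copy (suc n) b) (pairs (suc n))
            (λ (a , b) → ≐*-dec (copy (suc n) a) (copy (suc n) b)))
          (hyp (here refl))
          (copies⇒start n (hyp (there (here refl))) (hyp (here refl)) λ ι x s →
            ⊥E (⇒E (std (~ (cmp ≤ ⌜ + suc n ⌝ ⌜ + n ⌝)) (λ _ _ → suc≰))
              (atmostE x (numeral (+ suc n))
                (cast (trans (subst-atmost _ _ V₀ ⌜ + n ⌝) (cong (λ vs → atmost vs ⌜ + n ⌝) V₀≡))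
                  (hyp (ι (there (there (here refl))))))
                s)))))))
        -- Conversely, Std splits on N ≤ n or N ≥ n + 1; the second case gives n + 1 distinct
        -- tuples, which contradicts `noMore n`.
        (⇒I (⇔E₂ atmost-def (∀ᵍ*I m (∀ⁱI (⇒I (∨E (≤-or-≥ (ivar zero) n)
          (hyp (here refl))
          (⊥E (⇒E (⇒E
            (substitute {σ = Vec.lookup (Vec.map ⇑ V₀)} {λ ()} (λ ()) (⇒I (⇒I many⇒¬noMore)))
            (start⇒many n U (Vec.map ⇑ V₀) (hyp (there (here refl))) (hyp (here refl))))
            (cast (trans (sym (cong (weakenⁱ ∘ weakenᵍ* m) (⟨V₀⟩-id (noMore n)))) (weaken-⇑ (noMore n) V₀))
              (hyp (there (there (here refl)))))))))))))
        where
        suc≰ : ¬ compares ≤ (num (+ suc n)) (num (+ n))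
        suc≰ q = ℤₚ.<⇒≱ (ℤ.+<+ (ℕₚ.n<1+n n)) (num-≥⁻ (map₂ sym q))

    -- Bounds at which the counting formula is a logical constant

    module _ {r : Term} where
      private
        -- An arbitrary choice: Start at 0 holds of every tuple. The value N = 0 then witnesses
        -- Atleast when r ≤ 0 and refutes Atmost when r < 0.
        zeros : Vec (GTerm k 0) m
        zeros = Vec.replicate m ⌜ 0ℤ ⌝

        eval-r : ∀ (R : Term → Set) {g i} {μ : Fin g → Term} {ν : Fin i → ℤ} →
                 R r → R (evalᴳ μ ν (precomputed r))
        eval-r R = ≡.subst R (sym (evalᴳ-precomputed r))

        ⇑-r : ⇑ {k} {0} (precomputed r) ≡ precomputed r
        ⇑-r = trans (cong wkⁱ (substᴳ-precomputed _ _ r)) (substᴳ-precomputed _ _ r)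

      atleast⇔⊤ : compares ≥ (num 0ℤ) r → [] ⊢ atleast V₀ (precomputed r) ⇔ ⊤ᶠ
      atleast⇔⊤ q = ∧I (⇒I (⇒I (hyp (here refl))))
        (⇒I (atleastI zeros (numeral 0ℤ) (start-0 zeros V₀)
          (std (cmp ≥ ⌜ 0ℤ ⌝ (precomputed r)) (λ _ _ → eval-r (compares ≥ (num 0ℤ)) q))))

      atmost⇔⊥ : ¬ compares ≤ (num 0ℤ) r → [] ⊢ atmost V₀ (precomputed r) ⇔ ⊥ᶠ
      atmost⇔⊥ q = ∧I
        (⇒I (⇒E (std (~ (cmp ≤ ⌜ 0ℤ ⌝ (precomputed r))) (λ _ _ → eval-r (¬_ ∘ compares ≤ (num 0ℤ)) q))
          (atmostE zeros (numeral 0ℤ) (hyp (here refl)) (start-0 zeros V₀))))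
        (⇒I (⊥E (hyp (here refl))))

      atleast⇔⊥ : (∀ n → num n ≺ r) → [] ⊢ atleast V₀ (precomputed r) ⇔ ⊥ᶠ
      atleast⇔⊥ q = ∧I
        (⇒I (∃ᵍ*E m (⇔E₁ atleast-def (hyp (here refl))) (∃ⁱE (hyp (here refl))
          (⇒E (std (~ (cmp ≥ (int (ivar zero)) (precomputed r)))
                   (λ _ ν → eval-r (¬_ ∘ compares ≥ (num (ν zero))) (≱ (ν zero))))
              (cast (cong (cmp ≥ (int (ivar zero))) ⇑-r) (∧E₂ (hyp (here refl))))))))
        (⇒I (⊥E (hyp (here refl))))
        where
        ≱ : ∀ n → ¬ compares ≥ (num n) r
        ≱ n (inj₁ l)    = ≺-asym l (q n)
        ≱ n (inj₂ refl) = ≺-irrefl refl (q n)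

      atmost⇔⊤ : (∀ n → num n ≺ r) → [] ⊢ atmost V₀ (precomputed r) ⇔ ⊤ᶠ
      atmost⇔⊤ q = ∧I (⇒I (⇒I (hyp (here refl))))
        (⇒I (⇔E₂ atmost-def (∀ᵍ*I m (∀ⁱI (⇒I
          (cast (cong (cmp ≤ (int (ivar zero))) (sym ⇑-r))
            (std (cmp ≤ (int (ivar zero)) (precomputed r))
                 (λ _ ν → eval-r (compares ≤ (num (ν zero))) (inj₁ (q (ν zero)))))))))))

    -- The split is on `position r` because `∃≥` is defined by it and reduces in each of the cases.
    atleast⇔∃≥ : ∀ r → [] ⊢ atleast V₀ (precomputed r) ⇔ ∃≥ r
    atleast⇔∃≥ r with position r
    ... | isNum (+ suc n)  = atleast⇔many n
    ... | isNum (+ zero)   = atleast⇔⊤ (inj₂ refl)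
    ... | isNum (-[1+ n ]) = atleast⇔⊤ (num-≥⁺ ℤ.-≤+)
    ... | below q          = atleast⇔⊤ (inj₁ (q 0ℤ))
    ... | above q          = atleast⇔⊥ q

    atmost⇔∃≤ : ∀ r → [] ⊢ atmost V₀ (precomputed r) ⇔ ∃≤ r
    atmost⇔∃≤ r with position r
    ... | isNum (+ n)      = atmost⇔noMore n
    ... | isNum (-[1+ n ]) = atmost⇔⊥ λ q → ℤₚ.<⇒≱ ℤ.-<+ (num-≥⁻ (map₂ sym q))
    ... | below q          = atmost⇔⊥ λ { (inj₁ l) → ≺-asym l (q 0ℤ) ; (inj₂ refl) → ≺-irrefl refl (q 0ℤ) }
    ... | above q          = atmost⇔⊤ q

theorem2 : (L : Language) → let open HT# L in
    (m k : ℕ) (F : Form σ₀ (m + k) 0) → let open Counting m k F in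
    (r : Term) →
    Provable (close (atleast V₀ (precomputed r) ⇔ ∃≥ r))
    × Provable (close (atmost V₀ (precomputed r) ⇔ ∃≤ r))
theorem2 L m k F r = closeI L (atleast⇔∃≥ L m k F r) , closeI L (atmost⇔∃≤ L m k F r)
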